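{- Let $m\ge1$. There exists a unique most-perfect magic hypercube of order $4$ and dimension $m$ (with entries $1,\ldots,4^m$) up to the natural, faithful action of the group $W(B_{2m})\cong\mathrm{Aut}(Q_{2m})\cong\mathrm{Aut}_{\mathrm{graph}}(C_4^m)\cong C_2^{2m}\rtimes S_{2m}$; that is, the set of such hypercubes is nonempty and forms a single orbit under this faithful action.
   Context: A most-perfect magic hypercube of order $4$ and dimension $m$ is an arrangement of the numbers $1,2,\ldots,4^m$ in a $4\times\cdots\times4$ ($m$-fold) grid, with positions indexed by $(\mathbb Z/4\mathbb Z)^m$, such that: all orthogonal lines (four positions obtained by fixing all but one coordinate), all $2\times2$ subsquares (positions obtained by fixing all but two coordinates and letting those two range over $\{i,i+1\}\times\{k,k+1\}$ modulo $4$, so wrap-around subsquares are included), and all great diagonals and great pandiagonals sum to the same magic constant; and all pairs of entries lying two apart on any great pandiagonal sum to half the magic constant. A great pandiagonal is a toroidal line $\{p+t\,d: t\in\mathbb Z/4\mathbb Z\}$ with $p\in(\mathbb Z/4\mathbb Z)^m$ and $d\in\{\pm1\}^m$; great diagonals (the main diagonals of the grid) are special cases. $Q_{2m}$ is the hypercube graph on $\{0,1\}^{2m}$; $C_4^m$ is the $m$-fold Cartesian product of the $4$-cycle, i.e. the toroidal grid graph on the positions, which is isomorphic as a graph to $Q_{2m}$. The natural action is by permuting positions via graph automorphisms of $C_4^m$. $W(B_{2m})$ is the Weyl group of type $B_{2m}$ (the hyperoctahedral group of order $2^{2m}(2m)!$). -}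

module Defs where

open import Algebra.Bundles using (Group)
import Algebra.Construct.Pointwise as Pointwise
open import Algebra.Morphism.Structures using (module GroupMorphisms)
import Algebra.Properties.CommutativeMonoid.Sum as Sum
open import Data.Bool.Base using (Bool; if_then_else_)
open import Data.Empty using (⊥-elim)
open import Data.Fin.Base using (Fin; zero; suc; toℕ)
open import Data.Fin.Patterns using (0F; 1F; 2F; 3F)
open import Data.Fin.Properties using (_≟_)
open import Data.Integer.Base as ℤ using (ℤ; 0ℤ; 1ℤ; +_)
import Data.Integer.Properties as ℤ
open import Data.Integer.Tactic.RingSolver using (solve-∀)
open import Data.List.Base using (List; []; _∷_; _++_; reverse; [_])
open import Data.List.Properties using (++-assoc; ++-identityʳ; unfold-reverse; reverse-involutive)
open import Data.Nat.Base using (ℕ; zero; suc; _+_; _*_; _∸_; _^_)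
open import Data.Nat.DivMod using (_mod_)
import Data.Parity.Properties as Parity
open import Data.Product.Base using (∃-syntax; _×_; _,_)
open import Data.Sign.Base as Sign using (Sign)
open import Data.Sum.Base using (_⊎_; inj₁; inj₂; swap)
open import Data.Vec.Base using (Vec; lookup; zipWith; _[_]≔_)
open import Function.Base using (_∘_)
open import Function.Bundles using (_↔_; Inverse; _⇔_)
open import Function.Construct.Composition using (_↔-∘_; _⇔-∘_)
open import Function.Construct.Identity using (↔-id; ⇔-id)
open import Function.Construct.Symmetry using (↔-sym; ⇔-sym)
open import Function.Definitions using (Bijective)
open import Level using (Level; 0ℓ; _⊔_)
open import Relation.Binary.Bundles using (Setoid)
open import Relation.Binary.PropositionalEquality
  using (_≡_; _≢_; _≗_; refl; sym; trans; cong; cong₂; cong-app; subst₂; ≢-sym; module ≡-Reasoning)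
open import Relation.Nullary using (¬_; does; yes; no)

private
  variable
    c ℓ c′ ℓ′ : Level

record _≅_ (G : Group c ℓ) (H : Group c′ ℓ′) : Set (c ⊔ ℓ ⊔ c′ ⊔ ℓ′) where
  private
    module G = Group G
    module H = Group H
  field
    to                 : G.Carrier → H.Carrier
    isGroupIsomorphism : GroupMorphisms.IsGroupIsomorphism G.rawGroup H.rawGroup to

record Action (G : Group c ℓ) (X : Setoid c′ ℓ′) : Set (c ⊔ ℓ ⊔ c′ ⊔ ℓ′) where
  private
    module G = Group G
    module X = Setoid X
  infixr 8 _·_
  field
    _·_    : G.Carrier → X.Carrier → X.Carrier
    ·-cong : ∀ {g h x y} → g G.≈ h → x X.≈ y → g · x X.≈ h · y
    ε-act  : ∀ x → G.ε · x X.≈ x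
    ∙-act  : ∀ g h x → (g G.∙ h) · x X.≈ g · h · x

  Faithful : Set (c ⊔ ℓ ⊔ c′ ⊔ ℓ′)
  Faithful = ∀ g → (∀ x → g · x X.≈ x) → g G.≈ G.ε

  SingleOrbit : Set (c ⊔ c′ ⊔ ℓ′)
  SingleOrbit = X.Carrier × (∀ x y → ∃[ g ] g · x X.≈ y)

module _ (N : Group c ℓ) (H : Group c′ ℓ′) where
  private
    module N = Group N
    module H = Group H

  SemidirectProduct : (φ : Action H N.setoid) → let open Action φ in
                      (∀ h a b → h · (a N.∙ b) N.≈ (h · a) N.∙ (h · b)) →
                      Group (c ⊔ c′) (ℓ ⊔ ℓ′)
  SemidirectProduct φ ·-homo = record
    { Carrier = N.Carrier × H.Carrier
    ; _≈_     = λ (a , g) (b , h) → a N.≈ b × g H.≈ h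
    ; _∙_     = λ (a , g) (b , h) → a N.∙ (g · b) , g H.∙ h
    ; ε       = N.ε , H.ε
    ; _⁻¹     = λ (a , g) → (g H.⁻¹) · (a N.⁻¹) , g H.⁻¹
    ; isGroup = record
      { isMonoid = record
        { isSemigroup = record
          { isMagma = record
            { isEquivalence = record
              { refl  = N.refl , H.refl
              ; sym   = λ (p , q) → N.sym p , H.sym q
              ; trans = λ (p , q) (r , s) → N.trans p r , H.trans q s
              }
            ; ∙-cong = λ (p , q) (r , s) → N.∙-cong p (·-cong q r) , H.∙-cong q s
            }
          ; assoc = λ (a , g) (b , h) (d , k) →
              N.trans (N.assoc _ _ _)
                (N.∙-congˡ (N.trans (N.∙-congˡ (∙-act g h d)) (N.sym (·-homo g _ _))))
              , H.assoc g h k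
          }
        ; identity = (λ (a , g) → N.trans (N.identityˡ _) (ε-act a) , H.identityˡ g)
                   , (λ (a , g) → N.trans (N.∙-congˡ (·-ε g)) (N.identityʳ a) , H.identityʳ g)
        }
      ; inverse =
            (λ (a , g) → N.trans (N.sym (·-homo _ _ _))
                           (N.trans (·-cong H.refl (N.inverseˡ a)) (·-ε _))
                       , H.inverseˡ g)
          , (λ (a , g) → N.trans (N.∙-congˡ (N.trans (N.sym (∙-act _ _ _))
                           (N.trans (·-cong (H.inverseʳ g) N.refl) (ε-act _))))
                           (N.inverseʳ a)
                       , H.inverseʳ g)
      ; ⁻¹-cong = λ (p , q) → ·-cong (H.⁻¹-cong q) (N.⁻¹-cong p) , H.⁻¹-cong q
      }
    }
    where
    open Action φ
    open import Algebra.Properties.Group N using (identityˡ-unique)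
    ·-ε : ∀ g → g · N.ε N.≈ N.ε
    ·-ε g = identityˡ-unique _ _
      (N.trans (N.sym (·-homo g N.ε N.ε)) (·-cong H.refl (N.identityˡ _)))

module _ (A : Set) where
  open Inverse

  -- (σ ∙ τ) x = σ (τ x): σ ↔-∘ τ applies τ first.
  Sym : Group 0ℓ 0ℓ
  Sym = record
    { Carrier = A ↔ A
    ; _≈_     = λ σ τ → ∀ x → to σ x ≡ to τ x
    ; _∙_     = λ σ τ → σ ↔-∘ τ
    ; ε       = ↔-id A
    ; _⁻¹     = ↔-sym
    ; isGroup = record
      { isMonoid = record
        { isSemigroup = record
          { isMagma = record
            { isEquivalence = record
              { refl  = λ _ → refl
              ; sym   = λ p x → sym (p x)
              ; trans = λ p q x → trans (p x) (q x)
              }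
            ; ∙-cong = λ {σ} {σ′} {τ} {τ′} p q x → trans (p _) (cong (to σ′) (q x))
            }
          ; assoc = λ _ _ _ _ → refl
          }
        ; identity = (λ _ _ → refl) , (λ _ _ → refl)
        }
      ; inverse = (λ σ → strictlyInverseʳ σ) , (λ σ → strictlyInverseˡ σ)
      ; ⁻¹-cong = λ {σ} {τ} → from-cong′ σ τ
      }
    }
    where
    from-cong′ : (σ τ : A ↔ A) → (∀ x → to σ x ≡ to τ x) → ∀ x → from σ x ≡ from τ x
    from-cong′ σ τ p x = trans (cong (from σ) (sym (strictlyInverseˡ τ x)))
      (trans (cong (from σ) (sym (p (from τ x)))) (strictlyInverseʳ σ (from τ x)))

S : ℕ → Group 0ℓ 0ℓ
S n = Sym (Fin n)

C₂^ : ℕ → Group 0ℓ 0ℓ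
C₂^ n = Pointwise.group (Fin n) Parity.+-0-group

permuteCoordinates : ∀ n → Action (S n) (Group.setoid (C₂^ n))
permuteCoordinates n = record
  { _·_    = λ σ a i → a (from σ i)
  ; ·-cong = λ {σ} {τ} {a} {b} p q i →
               trans (cong a (Group.⁻¹-cong (S n) {σ} {τ} p i)) (q (from τ i))
  ; ε-act  = λ _ _ → refl
  ; ∙-act  = λ _ _ _ _ → refl
  }
  where open Inverse

C₂^_⋊S : ∀ n → Group 0ℓ 0ℓ
C₂^ n ⋊S = SemidirectProduct (C₂^ n) (S n) (permuteCoordinates n) (λ _ _ _ _ → refl)

record Graph : Set₁ where
  infix 4 _~_
  field
    Vertex   : Set
    _~_      : Vertex → Vertex → Set
    ~-sym    : ∀ {u v} → u ~ v → v ~ u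
    ~-irrefl : ∀ {u} → ¬ u ~ u

record Automorphism (G : Graph) : Set where
  open Graph G
  field
    perm : Vertex ↔ Vertex
  open Inverse perm public using (to; from)
  field
    preserves : ∀ {u v} → u ~ v ⇔ to u ~ to v

module _ (G : Graph) where
  open Graph G
  open Automorphism
  private
    module P = Group (Sym Vertex)

  Aut : Group 0ℓ 0ℓ
  Aut = record
    { Carrier = Automorphism G
    ; _≈_     = λ g h → perm g P.≈ perm h
    ; _∙_     = λ g h → record
      { perm = perm g P.∙ perm h ; preserves = preserves g ⇔-∘ preserves h }
    ; ε       = record { perm = P.ε ; preserves = ⇔-id _ }
    ; _⁻¹     = λ g → record
      { perm      = perm g P.⁻¹
      ; preserves = λ {u} {v} → ⇔-sym (subst₂ (λ x y → from g u ~ from g v ⇔ x ~ y)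
          (Inverse.strictlyInverseˡ (perm g) u)
          (Inverse.strictlyInverseˡ (perm g) v)
          (preserves g))
      }
    ; isGroup = record
      { isMonoid = record
        { isSemigroup = record
          { isMagma = record
            { isEquivalence = record
              { refl  = λ _ → refl
              ; sym   = λ p x → sym (p x)
              ; trans = λ p q x → trans (p x) (q x)
              }
            ; ∙-cong = λ {g} {g′} {h} {h′} →
                P.∙-cong {perm g} {perm g′} {perm h} {perm h′}
            }
          ; assoc = λ _ _ _ _ → refl
          }
        ; identity = (λ _ _ → refl) , (λ _ _ → refl)
        }
      ; inverse = (λ g → P.inverseˡ (perm g)) , (λ g → P.inverseʳ (perm g))
      ; ⁻¹-cong = λ {g} {h} → P.⁻¹-cong {perm g} {perm h}
      }
    }

-- The n-fold Cartesian product of a graph with itself: adjacent tuples are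
-- adjacent in one coordinate and equal in all others.
_□^_ : Graph → ℕ → Graph
G □^ n = record
  { Vertex   = Vec Vertex n
  ; _~_      = λ u v → ∃[ i ] lookup u i ~ lookup v i
                       × (∀ j → j ≢ i → lookup u j ≡ lookup v j)
  ; ~-sym    = λ (i , a , e) → i , ~-sym a , λ j j≢i → sym (e j j≢i)
  ; ~-irrefl = λ (_ , a , _) → ~-irrefl a
  }
  where open Graph G

K₂ : Graph
K₂ = record
  { Vertex   = Bool
  ; _~_      = _≢_
  ; ~-sym    = ≢-sym
  ; ~-irrefl = λ x≢x → x≢x refl
  }

Q : ℕ → Graph
Q n = K₂ □^ n

ℤ/4 : Set
ℤ/4 = Fin 4

infixl 6 _⊕_
_⊕_ : ℤ/4 → ℤ/4 → ℤ/4
a ⊕ b = (toℕ a + toℕ b) mod 4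

-- Multiplication by ±1.
infixl 7 _⊙_
_⊙_ : ℤ/4 → Sign → ℤ/4
a ⊙ Sign.+ = a
a ⊙ Sign.- = (4 ∸ toℕ a) mod 4

C₄ : Graph
C₄ = record
  { Vertex   = ℤ/4
  ; _~_      = λ a b → b ≡ a ⊕ 1F ⊎ a ≡ b ⊕ 1F
  ; ~-sym    = swap
  ; ~-irrefl = λ { (inj₁ e) → irr _ e ; (inj₂ e) → irr _ e }
  }
  where
  irr : ∀ a → a ≢ a ⊕ 1F
  irr 0F ()
  irr 1F ()
  irr 2F ()
  irr 3F ()

C₄^ : ℕ → Graph
C₄^ m = C₄ □^ m

-- A root is ± eᵢ, or ± eᵢ ± eⱼ with i ≢ j.  Each long root is named twice.
data Root (n : ℕ) : Set where
  short : Sign → Fin n → Root n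
  long  : Sign → Sign → (i j : Fin n) → i ≢ j → Root n

module _ {n : ℕ} where
  open Sum ℤ.+-0-commutativeMonoid using (sum)

  ⟨_,_⟩ : (u v : Fin n → ℤ) → ℤ
  ⟨ u , v ⟩ = sum λ k → u k ℤ.* v k

  e : Fin n → Fin n → ℤ
  e i k = if does (i ≟ k) then 1ℤ else 0ℤ

  vector : Root n → Fin n → ℤ
  vector (short s i)      k = (s ℤ.◃ 1) ℤ.* e i k
  vector (long s t i j _) k = (s ℤ.◃ 1) ℤ.* e i k ℤ.+ (t ℤ.◃ 1) ℤ.* e j k

  -- 2α / ⟨ α , α ⟩, where ⟨ α , α ⟩ is 1 for short and 2 for long roots.
  coroot : Root n → Fin n → ℤ
  coroot α@(short _ _)      k = + 2 ℤ.* vector α k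
  coroot α@(long _ _ _ _ _) k = vector α k

  reflect : Root n → (Fin n → ℤ) → (Fin n → ℤ)
  reflect α v k = v k ℤ.- ⟨ v , coroot α ⟩ ℤ.* vector α k

  act : List (Root n) → (Fin n → ℤ) → (Fin n → ℤ)
  act []      v = v
  act (α ∷ w) v = reflect α (act w v)

  open ≡-Reasoning

  private
    sum-cong : ∀ {m} {f g : Fin m → ℤ} → f ≗ g → sum f ≡ sum g
    sum-cong = Sum.sum-cong-≗ ℤ.+-0-commutativeMonoid

    sum-zero : ∀ {m} (f : Fin m → ℤ) → sum (λ k → 0ℤ ℤ.* f k) ≡ 0ℤ
    sum-zero {zero}  f = refl
    sum-zero {suc m} f = trans (ℤ.+-identityˡ _) (sum-zero (f ∘ suc))

    sum-e : ∀ {m} (i : Fin m) (f : Fin m → ℤ) →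
            sum (λ k → (if does (i ≟ k) then 1ℤ else 0ℤ) ℤ.* f k) ≡ f i
    sum-e zero    f = trans (cong₂ ℤ._+_ (ℤ.*-identityˡ (f zero)) (sum-zero (f ∘ suc)))
                            (ℤ.+-identityʳ _)
    sum-e (suc i) f = trans (ℤ.+-identityˡ _) (sum-e i (f ∘ suc))

    sum-linear : ∀ {m} (a b : ℤ) (f g h : Fin m → ℤ) →
                 sum (λ k → (a ℤ.* f k ℤ.+ b ℤ.* g k) ℤ.* h k)
                 ≡ a ℤ.* sum (λ k → f k ℤ.* h k) ℤ.+ b ℤ.* sum (λ k → g k ℤ.* h k)
    sum-linear {zero}  a b f g h = lemma a b
      where
      lemma : ∀ a b → 0ℤ ≡ a ℤ.* 0ℤ ℤ.+ b ℤ.* 0ℤ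
      lemma = solve-∀
    sum-linear {suc m} a b f g h =
      trans (cong (λ z → (a ℤ.* f zero ℤ.+ b ℤ.* g zero) ℤ.* h zero ℤ.+ z)
                  (sum-linear a b (f ∘ suc) (g ∘ suc) (h ∘ suc)))
            (lemma a b (f zero) (g zero) (h zero) _ _)
      where
      lemma : ∀ a b x y z p q →
        (a ℤ.* x ℤ.+ b ℤ.* y) ℤ.* z ℤ.+ (a ℤ.* p ℤ.+ b ℤ.* q)
        ≡ a ℤ.* (x ℤ.* z ℤ.+ p) ℤ.+ b ℤ.* (y ℤ.* z ℤ.+ q)
      lemma = solve-∀

    ⟨⟩-cong : ∀ {u u′ : Fin n → ℤ} v → u ≗ u′ → ⟨ u , v ⟩ ≡ ⟨ u′ , v ⟩
    ⟨⟩-cong v p = sum-cong λ k → cong (ℤ._* v k) (p k)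

    ⟨⟩-linear : ∀ a b (u v w : Fin n → ℤ) →
                ⟨ (λ k → a ℤ.* u k ℤ.+ b ℤ.* v k) , w ⟩ ≡ a ℤ.* ⟨ u , w ⟩ ℤ.+ b ℤ.* ⟨ v , w ⟩
    ⟨⟩-linear a b u v w = sum-linear a b u v w

    e-same : ∀ i → e i i ≡ 1ℤ
    e-same i with i ≟ i
    ... | yes _  = refl
    ... | no i≢i = ⊥-elim (i≢i refl)

    e-diff : ∀ {i j} → i ≢ j → e i j ≡ 0ℤ
    e-diff {i} {j} i≢j with i ≟ j
    ... | yes i≡j = ⊥-elim (i≢j i≡j)
    ... | no _    = refl

    ⟨α,α^∨⟩≡2 : ∀ α → ⟨ vector α , coroot α ⟩ ≡ + 2
    ⟨α,α^∨⟩≡2 α@(short s i) = begin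
      ⟨ vector α , coroot α ⟩
        ≡⟨ ⟨⟩-cong (coroot α) (λ k → pad σ (e i k)) ⟩
      ⟨ (λ k → σ ℤ.* e i k ℤ.+ 0ℤ ℤ.* e i k) , coroot α ⟩
        ≡⟨ ⟨⟩-linear σ 0ℤ (e i) (e i) (coroot α) ⟩
      σ ℤ.* ⟨ e i , coroot α ⟩ ℤ.+ 0ℤ
        ≡⟨ cong (λ z → σ ℤ.* z ℤ.+ 0ℤ) (sum-e i (coroot α)) ⟩
      σ ℤ.* (+ 2 ℤ.* (σ ℤ.* e i i)) ℤ.+ 0ℤ
        ≡⟨ cong (λ z → σ ℤ.* (+ 2 ℤ.* (σ ℤ.* z)) ℤ.+ 0ℤ) (e-same i) ⟩
      σ ℤ.* (+ 2 ℤ.* (σ ℤ.* 1ℤ)) ℤ.+ 0ℤ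
        ≡⟨ square s ⟩
      + 2 ∎
      where
      σ = s ℤ.◃ 1
      pad : ∀ a x → a ℤ.* x ≡ a ℤ.* x ℤ.+ 0ℤ ℤ.* x
      pad = solve-∀
      square : ∀ s → (s ℤ.◃ 1) ℤ.* (+ 2 ℤ.* ((s ℤ.◃ 1) ℤ.* 1ℤ)) ℤ.+ 0ℤ ≡ + 2
      square Sign.+ = refl
      square Sign.- = refl
    ⟨α,α^∨⟩≡2 α@(long s t i j i≢j) = begin
      ⟨ vector α , vector α ⟩
        ≡⟨ ⟨⟩-linear σ τ (e i) (e j) (vector α) ⟩
      σ ℤ.* ⟨ e i , vector α ⟩ ℤ.+ τ ℤ.* ⟨ e j , vector α ⟩
        ≡⟨ cong₂ (λ x y → σ ℤ.* x ℤ.+ τ ℤ.* y) (sum-e i (vector α)) (sum-e j (vector α)) ⟩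
      σ ℤ.* (σ ℤ.* e i i ℤ.+ τ ℤ.* e j i) ℤ.+ τ ℤ.* (σ ℤ.* e i j ℤ.+ τ ℤ.* e j j)
        ≡⟨ cong₂ (λ x y → σ ℤ.* x ℤ.+ τ ℤ.* y)
             (cong₂ (λ x y → σ ℤ.* x ℤ.+ τ ℤ.* y) (e-same i) (e-diff (≢-sym i≢j)))
             (cong₂ (λ x y → σ ℤ.* x ℤ.+ τ ℤ.* y) (e-diff i≢j) (e-same j)) ⟩
      σ ℤ.* (σ ℤ.* 1ℤ ℤ.+ τ ℤ.* 0ℤ) ℤ.+ τ ℤ.* (σ ℤ.* 0ℤ ℤ.+ τ ℤ.* 1ℤ)
        ≡⟨ squares s t ⟩
      + 2 ∎
      where
      σ = s ℤ.◃ 1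
      τ = t ℤ.◃ 1
      squares : ∀ s t → let σ = s ℤ.◃ 1 ; τ = t ℤ.◃ 1 in
        σ ℤ.* (σ ℤ.* 1ℤ ℤ.+ τ ℤ.* 0ℤ) ℤ.+ τ ℤ.* (σ ℤ.* 0ℤ ℤ.+ τ ℤ.* 1ℤ) ≡ + 2
      squares Sign.+ Sign.+ = refl
      squares Sign.+ Sign.- = refl
      squares Sign.- Sign.+ = refl
      squares Sign.- Sign.- = refl

  reflect-cong : ∀ α {u v} → u ≗ v → reflect α u ≗ reflect α v
  reflect-cong α p k = cong₂ (λ x y → x ℤ.- y ℤ.* vector α k) (p k) (⟨⟩-cong (coroot α) p)

  reflect-involutive : ∀ α v → reflect α (reflect α v) ≗ v
  reflect-involutive α v k = begin
    v k ℤ.- a ℤ.* x ℤ.- ⟨ reflect α v , coroot α ⟩ ℤ.* x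
      ≡⟨ cong (λ z → v k ℤ.- a ℤ.* x ℤ.- z ℤ.* x) (begin
           ⟨ reflect α v , coroot α ⟩
             ≡⟨ ⟨⟩-cong (coroot α) (λ k → pad (v k) a (vector α k)) ⟩
           ⟨ (λ k → 1ℤ ℤ.* v k ℤ.+ (ℤ.- a) ℤ.* vector α k) , coroot α ⟩
             ≡⟨ ⟨⟩-linear 1ℤ (ℤ.- a) v (vector α) (coroot α) ⟩
           1ℤ ℤ.* a ℤ.+ (ℤ.- a) ℤ.* ⟨ vector α , coroot α ⟩
             ≡⟨ cong (λ z → 1ℤ ℤ.* a ℤ.+ (ℤ.- a) ℤ.* z) (⟨α,α^∨⟩≡2 α) ⟩
           1ℤ ℤ.* a ℤ.+ (ℤ.- a) ℤ.* + 2 ∎) ⟩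
    v k ℤ.- a ℤ.* x ℤ.- (1ℤ ℤ.* a ℤ.+ (ℤ.- a) ℤ.* + 2) ℤ.* x
      ≡⟨ cancel (v k) a x ⟩
    v k ∎
    where
    a = ⟨ v , coroot α ⟩
    x = vector α k
    pad : ∀ y a x → y ℤ.- a ℤ.* x ≡ 1ℤ ℤ.* y ℤ.+ (ℤ.- a) ℤ.* x
    pad = solve-∀
    cancel : ∀ y a x → y ℤ.- a ℤ.* x ℤ.- (1ℤ ℤ.* a ℤ.+ (ℤ.- a) ℤ.* + 2) ℤ.* x ≡ y
    cancel = solve-∀

  act-cong : ∀ w {u v} → u ≗ v → act w u ≗ act w v
  act-cong []      p = p
  act-cong (α ∷ w) p = reflect-cong α (act-cong w p)

  act-++ : ∀ w w′ v → act (w ++ w′) v ≡ act w (act w′ v)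
  act-++ []      w′ v = refl
  act-++ (α ∷ w) w′ v = cong (reflect α) (act-++ w w′ v)

  act-reverseˡ : ∀ w v → act (reverse w) (act w v) ≗ v
  act-reverseˡ []      v k = refl
  act-reverseˡ (α ∷ w) v k = begin
    act (reverse (α ∷ w)) (reflect α (act w v)) k
      ≡⟨ cong (λ z → act z (reflect α (act w v)) k) (unfold-reverse α w) ⟩
    act (reverse w ++ [ α ]) (reflect α (act w v)) k
      ≡⟨ cong (λ f → f k) (act-++ (reverse w) [ α ] (reflect α (act w v))) ⟩
    act (reverse w) (reflect α (reflect α (act w v))) k
      ≡⟨ act-cong (reverse w) (reflect-involutive α (act w v)) k ⟩
    act (reverse w) (act w v) k
      ≡⟨ act-reverseˡ w v k ⟩
    v k ∎

  act-reverseʳ : ∀ w v → act w (act (reverse w) v) ≗ v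
  act-reverseʳ w v k =
    trans (cong (λ z → act z (act (reverse w) v) k) (sym (reverse-involutive w)))
          (act-reverseˡ (reverse w) v k)

-- The group generated by the reflections in the roots, as words in these
-- reflections identified when they act equally on ℤⁿ, the root lattice.
-- Reflections are involutions, so words need no formal inverses.
WeylB : ℕ → Group 0ℓ 0ℓ
WeylB n = record
  { Carrier = List (Root n)
  ; _≈_     = λ w w′ → ∀ v → act w v ≗ act w′ v
  ; _∙_     = _++_
  ; ε       = []
  ; _⁻¹     = reverse
  ; isGroup = record
    { isMonoid = record
      { isSemigroup = record
        { isMagma = record
          { isEquivalence = record
            { refl  = λ _ _ → refl
            ; sym   = λ p v k → sym (p v k)
            ; trans = λ p q v k → trans (p v k) (q v k)
            }
          ; ∙-cong = λ {x} {x′} {y} {y′} p q v k →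
              trans (cong-app (act-++ x y v) k)
              (trans (act-cong x (q v) k)
              (trans (p (act y′ v) k)
                     (cong-app (sym (act-++ x′ y′ v)) k)))
          }
        ; assoc = λ x y z v k → cong (λ w → act w v k) (++-assoc x y z)
        }
      ; identity = (λ _ _ _ → refl)
                 , (λ w v k → cong (λ x → act x v k) (++-identityʳ w))
      }
    ; inverse = (λ w v k → trans (cong-app (act-++ (reverse w) w v) k) (act-reverseˡ w v k))
              , (λ w v k → trans (cong-app (act-++ w (reverse w) v) k) (act-reverseʳ w v k))
    ; ⁻¹-cong = λ {w} {w′} p v k →
        trans (act-cong (reverse w) (λ j → sym (act-reverseʳ w′ v j)) k)
        (trans (act-cong (reverse w) (λ j → sym (p (act (reverse w′) v) j)) k)
               (act-reverseˡ w (act (reverse w′) v) k))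
    }
  }

Position : ℕ → Set
Position m = Vec ℤ/4 m

Direction : ℕ → Set
Direction m = Vec Sign m

pandiagonal : ∀ {m} → Position m → Direction m → ℤ/4 → Position m
pandiagonal p d t = zipWith (λ a s → a ⊕ t ⊙ s) p d

sum₄ : (ℤ/4 → ℕ) → ℕ
sum₄ f = f 0F + f 1F + f 2F + f 3F

-- The great diagonals are pandiagonals, so pandiagonal-sum covers them.
record IsMostPerfect {m : ℕ} (entry : Position m → ℕ) : Set where
  field
    magicConstant : ℕ
    line-sum : ∀ i p →
      sum₄ (λ t → entry (p [ i ]≔ t)) ≡ magicConstant
    subsquare-sum : ∀ {i j} → i ≢ j → ∀ p a b →
      let square = λ x y → entry ((p [ i ]≔ x) [ j ]≔ y) in
      square a b + square a (b ⊕ 1F) + square (a ⊕ 1F) b + square (a ⊕ 1F) (b ⊕ 1F)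
        ≡ magicConstant
    pandiagonal-sum : ∀ p d →
      sum₄ (λ t → entry (pandiagonal p d t)) ≡ magicConstant
    half-sum : ∀ p d t →
      2 * (entry (pandiagonal p d t) + entry (pandiagonal p d (t ⊕ 2F))) ≡ magicConstant

record MostPerfectHypercube (m : ℕ) : Set where
  field
    index     : Position m → Fin (4 ^ m)
    bijective : Bijective _≡_ _≡_ index

  -- The numbers 1, …, 4ᵐ, whereas Fin starts at 0.
  entry : Position m → ℕ
  entry p = suc (toℕ (index p))

  field
    isMostPerfect : IsMostPerfect entry

MostPerfectHypercubes : ℕ → Setoid 0ℓ 0ℓ
MostPerfectHypercubes m = record
  { Carrier       = MostPerfectHypercube m
  ; _≈_           = λ H K → ∀ p → entry H p ≡ entry K p
  ; isEquivalence = record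
    { refl  = λ _ → refl
    ; sym   = λ e p → sym (e p)
    ; trans = λ e f p → trans (e p) (f p)
    }
  }
  where open MostPerfectHypercube

-- The entry of H at p moves to ρ g p.
PermutesPositionsVia : ∀ {m} {G : Group 0ℓ 0ℓ} →
  Action G (MostPerfectHypercubes m) → (Group.Carrier G → Automorphism (C₄^ m)) → Set
PermutesPositionsVia A ρ = ∀ g H p → entry (g · H) (Automorphism.to (ρ g) p) ≡ entry H p
  where
  open Action A
  open MostPerfectHypercube

{-# OPTIONS --safe #-}
module Submission where

-- Gray coding each coordinate of a position turns C₄ᵐ into Q₂ₘ, lines and 2×2
-- subsquares into 2-faces, and the shift by (2, …, 2) into the antipodal map.  So
-- entries are most perfect iff for some c all antipodal pairs sum to c and all
-- 2-faces sum to 2c, a condition preserved by Aut (Q₂ₘ).  The automorphisms are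
-- the signed permutations, because an automorphism permutes the edge directions
-- in the same way at every vertex.
--
-- Let twist x = x + |x| (1, …, 1) over 𝔽₂, an involution as 2m is even.  Flipping a
-- coordinate of x moves twist x to the antipode of a neighbour, so E satisfies the
-- condition iff E ∘ twist is affine, i.e. from a vertex with the least entry it is
-- a sum of one weight for each flipped coordinate.  Subset sums enumerate
-- 0, …, 2²ᵐ − 1 only if the weights are the powers of two in some order.  Hence up
-- to a signed permutation E ∘ twist reads off binary numerals.

open import Algebra.Bundles using (Group)
open import Algebra.Morphism.Structures using (module GroupMorphisms)
import Algebra.Morphism.Construct.Composition as Composition
import Algebra.Properties.CommutativeMonoid.Sum as Sum
import Algebra.Properties.Group as GroupProperties
open import Data.Bool.Base using (Bool; true; false; not; _xor_; _∨_; if_then_else_)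
open import Data.Bool.Properties
  using (not-involutive; not-¬; ¬-not; xor-assoc; xor-comm; xor-same; xor-identityʳ;
         xor-annihilates-not; not-distribˡ-xor; not-distribʳ-xor)
open import Data.Empty using (⊥-elim)
open import Data.Fin.Base
  using (Fin; zero; suc; toℕ; fromℕ<; combine; remQuot; punchIn; punchOut)
open import Data.Fin.Patterns using (0F; 1F; 2F; 3F)
open import Data.Fin.Permutation as Permutation
  using (Permutation; _⟨$⟩ʳ_; insert)
import Data.Fin.Permutation.Components as Components
open import Data.Fin.Permutation.Transposition.List
  using (TranspositionList; eval; decompose; eval-decompose)
open import Data.Fin.Properties
  using (_≟_; all?; toℕ-injective; toℕ-fromℕ<; toℕ<n; punchIn-punchOut;
         remQuot-combine; combine-surjective; combine-injectiveˡ; combine-injectiveʳ)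
open import Data.Integer.Base as ℤ using (ℤ)
import Data.Integer.Properties as ℤ
import Data.Integer.Tactic.RingSolver as ℤ-Solver
open import Data.List.Base using (List; []; _∷_; _++_)
open import Data.Nat.Base using (ℕ; zero; suc; _+_; _*_; _^_; _≤_; _<_; z≤n; s≤s)
import Data.Nat.Properties as ℕ
open import Data.Nat.Tactic.RingSolver using (solve-∀)
open import Data.Parity.Base as ℙ using (Parity; 0ℙ; 1ℙ; toSign; fromSign)
import Data.Parity.Properties as ℙ
open import Data.Product.Base using (Σ-syntax; ∃-syntax; _×_; _,_; proj₁; proj₂)
open import Data.Sign.Base as Sign using (Sign)
import Data.Sign.Properties as Sign
open import Data.Sum.Base using (_⊎_; inj₁; inj₂)
open import Data.Vec.Base
  using (Vec; []; _∷_; lookup; tabulate; map; replicate; insertAt; removeAt; _[_]%=_; _[_]≔_)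
open import Data.Vec.Properties
  using (lookup∘tabulate; tabulate∘lookup; tabulate-cong; lookup-map; lookup-replicate;
         lookup-zipWith; lookup∘updateAt; lookup∘updateAt′; updateAt-id; updateAt-id-local;
         updateAt-updateAt; updateAt-updateAt-local; updateAt-cong-local; updateAt-commutes;
         []≔-lookup; map-id; map-∘; map-cong; insertAt-lookup; insertAt-punchIn;
         insertAt-removeAt; removeAt-insertAt)
open import Function.Base using (_∘_; id)
open import Function.Bundles using (_↔_; _⇔_; Inverse; Equivalence; mk⇔; mk↔ₛ′)
open import Function.Construct.Identity using (↔-id)
open import Level using (Level)
open import Relation.Binary.PropositionalEquality
  using (_≡_; _≢_; _≗_; refl; sym; trans; cong; cong₂; subst; subst₂; ≢-sym; module ≡-Reasoning)
open import Relation.Nullary using (Dec; yes; no; does; contradiction)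
open import Relation.Nullary.Decidable
  using (does-⇔; decidable-stable; dec-true; dec-false; toWitness)
open import Defs

open ≡-Reasoning
private
  module ∑ℤ = Sum ℤ.+-0-commutativeMonoid
open Sum ℕ.+-0-commutativeMonoid using (sum; sum-cong-≗; sum-remove; sum-permute)

-- The twist comes from Fourier analysis on 𝔽₂ⁿ with n = 2m. Take `E` as in `Perfect` and subtract
-- half its antipodal sum. The antipodal condition leaves only the characters x ↦ (-1)^(sum of xᵢ
-- over i ∈ S) with |S| odd. The sum of such a character over every 2-face in directions k, l
-- vanishes exactly when S contains k or l, so the face condition leaves only the sets S that miss
-- at most one index. As n is even, |S| = n - 1. The character omitting i is the i-th coordinate
-- character composed with `twist`, so `E ∘ twist` has only constant and linear terms.
-- `perfect⇒affine` gets the same conclusion by cancellation in ℕ.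
--
-- There remains an obstacle: the symmetries that normalise `E ∘ twist` have to be symmetries of
-- `E`. They are, because `twist` normalises the group of signed permutations: it turns a flip into
-- a flip followed by the antipodal map, which commutes with every signed permutation, and a
-- conjugate contains two twists, so that the two antipodal maps cancel.

private
  variable
    g₁ ℓ₁ g₂ ℓ₂ g₃ ℓ₃ : Level
    m n : ℕ
  module B {n} = Group (C₂^ n ⋊S)

-- Isomorphisms of groups and of automorphism groups

module _ {G : Group g₁ ℓ₁} {H : Group g₂ ℓ₂} where
  private
    module G = Group G
    module H = Group H

  -- Compatibility with products is enough: the images of the identity and of inverses solve
  -- equations in `H` that have only one solution.
  mk≅ : (f : G.Carrier → H.Carrier) →
        (∀ {x y} → x G.≈ y → f x H.≈ f y) →
        (∀ x y → f (x G.∙ y) H.≈ f x H.∙ f y) →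
        (∀ {x y} → f x H.≈ f y → x G.≈ y) →
        (∀ y → ∃[ x ] f x H.≈ y) →
        G ≅ H
  mk≅ f f-cong homo injective surjective = record
    { to = f
    ; isGroupIsomorphism = record
      { isGroupMonomorphism = record
        { isGroupHomomorphism = record
          { isMonoidHomomorphism = record
            { isMagmaHomomorphism = record
              { isRelHomomorphism = record { cong = f-cong }
              ; homo = homo
              }
            ; ε-homo = ε-homo
            }
          ; ⁻¹-homo = λ x → inverseˡ-unique (f (x G.⁻¹)) (f x)
              (H.trans (H.sym (homo _ _)) (H.trans (f-cong (G.inverseˡ x)) ε-homo))
          }
        ; injective = injective
        }
      ; surjective = λ y → proj₁ (surjective y) ,
          λ z≈x → H.trans (f-cong z≈x) (proj₂ (surjective y))
      }
    }
    where
    open GroupProperties H using (identityˡ-unique; inverseˡ-unique)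
    ε-homo : f G.ε H.≈ H.ε
    ε-homo = identityˡ-unique _ _ (H.trans (H.sym (homo _ _)) (f-cong (G.identityˡ G.ε)))

module _ {G : Group g₁ ℓ₁} {H : Group g₂ ℓ₂} where
  private
    module G = Group G
    module H = Group H

  ≅-sym : G ≅ H → H ≅ G
  ≅-sym φ = mk≅ from
    (λ p → injective (H.trans (to-from _) (H.trans p (H.sym (to-from _)))))
    (λ x y → injective (H.trans (to-from _)
      (H.trans (H.sym (H.∙-cong (to-from _) (to-from _))) (H.sym (∙-homo _ _)))))
    (λ p → H.trans (H.sym (to-from _)) (H.trans (⟦⟧-cong p) (to-from _)))
    (λ x → to x , injective (to-from _))
    where
    open _≅_ φ
    open GroupMorphisms.IsGroupIsomorphism isGroupIsomorphism
    from : H.Carrier → G.Carrier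
    from y = proj₁ (surjective y)
    to-from : ∀ y → to (from y) H.≈ y
    to-from y = proj₂ (surjective y) G.refl

≅-trans : {G : Group g₁ ℓ₁} {H : Group g₂ ℓ₂} {K : Group g₃ ℓ₃} → G ≅ H → H ≅ K → G ≅ K
≅-trans {K = K} φ ψ = record
  { to = _≅_.to ψ ∘ _≅_.to φ
  ; isGroupIsomorphism = Composition.isGroupIsomorphism (Group.trans K)
      (_≅_.isGroupIsomorphism φ) (_≅_.isGroupIsomorphism ψ)
  }

module _ {G : Graph} where
  private
    module G = Graph G

  -- The backward half of `preserves` is the hypothesis on the inverse, applied to the image edge.
  automorphism : (σ : G.Vertex ↔ G.Vertex) → let open Inverse σ in
                 (∀ {u v} → u G.~ v → to u G.~ to v) →
                 (∀ {u v} → u G.~ v → from u G.~ from v) → Automorphism G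
  automorphism σ p q = record
    { perm = σ
    ; preserves = mk⇔ p λ e → subst₂ G._~_ (strictlyInverseʳ _) (strictlyInverseʳ _) (q e)
    }
    where open Inverse σ

conjugate : ∀ {G H : Graph} (β : Graph.Vertex G ↔ Graph.Vertex H) →
            (∀ {u v} → Graph._~_ G u v ⇔ Graph._~_ H (Inverse.to β u) (Inverse.to β v)) →
            Aut G ≅ Aut H
conjugate {G} {H} β β-~ = mk≅ (conj {G} {H} β β-~)
  (λ p y → cong to (p (from y)))
  (λ g h y → cong (to ∘ A.to g) (sym (strictlyInverseʳ _)))
  (λ {g} {h} p x → trans (sym (strictlyInverseʳ _))
    (trans (cong from (trans (cong (to ∘ A.to g) (sym (strictlyInverseʳ x)))
      (trans (p (to x)) (cong (to ∘ A.to h) (strictlyInverseʳ x)))))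
     (strictlyInverseʳ _)))
  (λ k → conj {H} {G} (mk↔ₛ′ from to strictlyInverseʳ strictlyInverseˡ) β-~′ k ,
     λ y → trans (strictlyInverseˡ _) (cong (A.to k) (strictlyInverseˡ y)))
  where
  open Inverse β
  open Graph using (Vertex; _~_)
  module A {G} = Automorphism {G}
  β-~′ : ∀ {u v} → _~_ H u v ⇔ _~_ G (from u) (from v)
  β-~′ {u} {v} = mk⇔
    (λ e → Equivalence.from β-~
      (subst₂ (_~_ H) (sym (strictlyInverseˡ u)) (sym (strictlyInverseˡ v)) e))
    (λ e → subst₂ (_~_ H) (strictlyInverseˡ u) (strictlyInverseˡ v) (Equivalence.to β-~ e))
  -- Generic in both graphs, so that its instance for the inverse of `β` supplies the preimages for
  -- surjectivity.
  conj : ∀ {G H} (β : Vertex G ↔ Vertex H) →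
         (∀ {u v} → _~_ G u v ⇔ _~_ H (Inverse.to β u) (Inverse.to β v)) →
         Automorphism G → Automorphism H
  conj {G} {H} β β-~ g = automorphism {H}
    (mk↔ₛ′ (b.to ∘ A.to g ∘ b.from) (b.to ∘ A.from g ∘ b.from)
      (λ y → trans (cong (b.to ∘ A.to g) (b.strictlyInverseʳ _))
        (trans (cong b.to (g.strictlyInverseˡ _)) (b.strictlyInverseˡ y)))
      (λ y → trans (cong (b.to ∘ A.from g) (b.strictlyInverseʳ _))
        (trans (cong b.to (g.strictlyInverseʳ _)) (b.strictlyInverseˡ y))))
    (λ e → Equivalence.to β-~ (Equivalence.to (A.preserves g) (from-~ e)))
    (λ e → Equivalence.to β-~ (Equivalence.from (A.preserves g)
       (subst₂ (_~_ G) (sym (g.strictlyInverseˡ _)) (sym (g.strictlyInverseˡ _)) (from-~ e))))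
    where
    module b = Inverse β
    module g = Inverse (A.perm g)
    from-~ : ∀ {u v} → _~_ H u v → _~_ G (b.from u) (b.from v)
    from-~ e = Equivalence.from β-~
      (subst₂ (_~_ H) (sym (b.strictlyInverseˡ _)) (sym (b.strictlyInverseˡ _)) e)

-- Automorphisms of the hypercube graph are signed permutations

lookup-ext : ∀ {A : Set} {x y : Vec A n} → lookup x ≗ lookup y → x ≡ y
lookup-ext {x = x} {y} p =
  trans (sym (tabulate∘lookup x)) (trans (tabulate-cong p) (tabulate∘lookup y))

zeros : Vec Bool n
zeros = replicate _ false

flip : Fin n → Vec Bool n → Vec Bool n
flip i x = x [ i ]%= not

lookup-flip : ∀ i j (x : Vec Bool n) → lookup (flip i x) j ≡ does (i ≟ j) xor lookup x j
lookup-flip zero    zero    (_ ∷ _) = refl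
lookup-flip zero    (suc j) (_ ∷ _) = refl
lookup-flip (suc i) zero    (_ ∷ _) = refl
lookup-flip (suc i) (suc j) (_ ∷ x) = lookup-flip i j x

flip-involutive : ∀ i (x : Vec Bool n) → flip i (flip i x) ≡ x
flip-involutive i x =
  trans (updateAt-updateAt i x) (updateAt-id-local i x (not-involutive _))

-- Compare coordinate `a`: the left side flips it exactly once, and on the right `c` does not touch
-- it, so `d` must.
flip-flip-at : ∀ {a b c d} {x : Vec Bool n} →
               flip b (flip a x) ≡ flip d (flip c x) → a ≢ b → a ≢ c → a ≡ d
flip-flip-at {a = a} {b} {c} {d} {x} p a≢b a≢c = decidable-stable (a ≟ d) λ a≢d →
  not-¬ refl (sym (begin
    not (lookup x a)               ≡⟨ lookup∘updateAt a x ⟨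
    lookup (flip a x) a            ≡⟨ lookup∘updateAt′ a b a≢b (flip a x) ⟨
    lookup (flip b (flip a x)) a   ≡⟨ cong (λ z → lookup z a) p ⟩
    lookup (flip d (flip c x)) a   ≡⟨ lookup∘updateAt′ a d a≢d (flip c x) ⟩
    lookup (flip c x) a            ≡⟨ lookup∘updateAt′ a c a≢c x ⟩
    lookup x a                     ∎))

flip-injective : ∀ {i j} (x : Vec Bool n) → flip i x ≡ flip j x → i ≡ j
flip-injective {i = i} {j} x p = decidable-stable (i ≟ j) λ i≢j →
  i≢j (flip-flip-at
    (trans (cong (flip j) p) (trans (flip-involutive j x) (sym (flip-involutive j x)))) i≢j i≢j)

flip-~ : ∀ i (x : Vec Bool n) → Graph._~_ (Q n) x (flip i x)
flip-~ i x = i , (λ p → not-¬ refl (trans p (lookup∘updateAt i x))) ,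
  λ j j≢i → sym (lookup∘updateAt′ j i j≢i x)

~-flip : ∀ (x y : Vec Bool n) → Graph._~_ (Q n) x y → ∃[ i ] y ≡ flip i x
~-flip x y (i , xᵢ≢yᵢ , same) = i , lookup-ext eq
  where
  eq : lookup y ≗ lookup (flip i x)
  eq j with j ≟ i
  ... | yes refl = trans (¬-not (≢-sym xᵢ≢yᵢ)) (sym (lookup∘updateAt i x))
  ... | no  j≢i  = trans (sym (same j j≢i)) (sym (lookup∘updateAt′ j i j≢i x))

-- Connectedness of the hypercube as an induction principle: what is known at `zeros` and survives
-- every edge holds everywhere.
flip-induction : (P : Vec Bool n → Set) → P zeros → (∀ i {x} → P x → P (flip i x)) → ∀ x → P x
flip-induction P base step []          = base
flip-induction P base step (false ∷ x) = flip-induction (P ∘ (false ∷_)) base (λ i → step (suc i)) x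
flip-induction P base step (true ∷ x)  =
  step zero (flip-induction (P ∘ (false ∷_)) base (λ i → step (suc i)) x)

negate : Vec Bool n → Vec Bool n
negate = map not

negate-involutive : (x : Vec Bool n) → negate (negate x) ≡ x
negate-involutive x = trans (sym (map-∘ not not x)) (trans (map-cong not-involutive x) (map-id x))

negate-flip : ∀ i (x : Vec Bool n) → negate (flip i x) ≡ flip i (negate x)
negate-flip zero    (_ ∷ _) = refl
negate-flip (suc i) (b ∷ x) = cong (not b ∷_) (negate-flip i x)

bit : Parity → Bool
bit 0ℙ = false
bit 1ℙ = true

parity : Bool → Parity
parity false = 0ℙ
parity true  = 1ℙ

bit-parity : ∀ b → bit (parity b) ≡ b
bit-parity false = refl
bit-parity true  = refl

bit-injective : ∀ {p q} → bit p ≡ bit q → p ≡ q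
bit-injective {0ℙ} {0ℙ} _ = refl
bit-injective {1ℙ} {1ℙ} _ = refl

bit-+ : ∀ p q → bit (p ℙ.+ q) ≡ bit p xor bit q
bit-+ 0ℙ q  = refl
bit-+ 1ℙ 0ℙ = refl
bit-+ 1ℙ 1ℙ = refl

xor-cancelˡ : ∀ a b → a xor (a xor b) ≡ b
xor-cancelˡ false b = refl
xor-cancelˡ true  b = not-involutive b

Signed : ℕ → Set
Signed n = Group.Carrier (C₂^ n ⋊S)

-- The affine map x ↦ a + σx over 𝔽₂: coordinates are permuted before the translation, the order for
-- which `signed` respects the product of `C₂^ n ⋊S`.
signed signed⁻¹ : Signed n → Vec Bool n → Vec Bool n
signed   (a , σ) x = tabulate λ i → bit (a i) xor lookup x (Inverse.from σ i)
signed⁻¹ (a , σ) y = tabulate λ i → bit (a (Inverse.to σ i)) xor lookup y (Inverse.to σ i)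

module _ (g : Signed n) where
  private
    a = proj₁ g
    σ = proj₂ g
  open Inverse σ

  signed-flip : ∀ i x → signed (a , σ) (flip i x) ≡ flip (to i) (signed (a , σ) x)
  signed-flip i x = lookup-ext λ j → begin
    lookup (signed (a , σ) (flip i x)) j
      ≡⟨ lookup∘tabulate _ j ⟩
    bit (a j) xor lookup (flip i x) (from j)
      ≡⟨ cong (bit (a j) xor_) (lookup-flip i (from j) x) ⟩
    bit (a j) xor (does (i ≟ from j) xor lookup x (from j))
      ≡⟨ cong (λ d → bit (a j) xor (d xor lookup x (from j)))
           (does-⇔ (mk⇔ (λ p → inverseˡ p) (λ p → sym (inverseʳ (sym p)))) (i ≟ from j) (to i ≟ j)) ⟩
    bit (a j) xor (does (to i ≟ j) xor lookup x (from j))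
      ≡⟨ xor-swap (bit (a j)) (does (to i ≟ j)) _ ⟩
    does (to i ≟ j) xor (bit (a j) xor lookup x (from j))
      ≡⟨ cong (does (to i ≟ j) xor_) (lookup∘tabulate _ j) ⟨
    does (to i ≟ j) xor lookup (signed (a , σ) x) j
      ≡⟨ lookup-flip (to i) j (signed (a , σ) x) ⟨
    lookup (flip (to i) (signed (a , σ) x)) j ∎
    where
    xor-swap : ∀ a b c → a xor (b xor c) ≡ b xor (a xor c)
    xor-swap a b c = trans (sym (xor-assoc a b c))
      (trans (cong (_xor c) (xor-comm a b)) (xor-assoc b a c))

  signed-signed⁻¹ : ∀ y → signed (a , σ) (signed⁻¹ (a , σ) y) ≡ y
  signed-signed⁻¹ y = lookup-ext λ i → begin
    lookup (signed (a , σ) (signed⁻¹ (a , σ) y)) i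
      ≡⟨ lookup∘tabulate _ i ⟩
    bit (a i) xor lookup (signed⁻¹ (a , σ) y) (from i)
      ≡⟨ cong (bit (a i) xor_) (lookup∘tabulate _ (from i)) ⟩
    bit (a i) xor (bit (a (to (from i))) xor lookup y (to (from i)))
      ≡⟨ cong (λ j → bit (a i) xor (bit (a j) xor lookup y j)) (strictlyInverseˡ i) ⟩
    bit (a i) xor (bit (a i) xor lookup y i)
      ≡⟨ xor-cancelˡ (bit (a i)) _ ⟩
    lookup y i ∎

  signed⁻¹-signed : ∀ x → signed⁻¹ (a , σ) (signed (a , σ) x) ≡ x
  signed⁻¹-signed x = lookup-ext λ i → begin
    lookup (signed⁻¹ (a , σ) (signed (a , σ) x)) i
      ≡⟨ lookup∘tabulate _ i ⟩
    bit (a (to i)) xor lookup (signed (a , σ) x) (to i)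
      ≡⟨ cong (bit (a (to i)) xor_) (lookup∘tabulate _ (to i)) ⟩
    bit (a (to i)) xor (bit (a (to i)) xor lookup x (from (to i)))
      ≡⟨ xor-cancelˡ (bit (a (to i))) _ ⟩
    lookup x (from (to i))
      ≡⟨ cong (lookup x) (strictlyInverseʳ i) ⟩
    lookup x i ∎

  signed⁻¹-flip : ∀ i y → signed⁻¹ (a , σ) (flip i y) ≡ flip (from i) (signed⁻¹ (a , σ) y)
  signed⁻¹-flip i y = begin
    signed⁻¹ (a , σ) (flip i y)
      ≡⟨ cong₂ (λ j z → signed⁻¹ (a , σ) (flip j z)) (strictlyInverseˡ i) (signed-signed⁻¹ y) ⟨
    signed⁻¹ (a , σ) (flip (to (from i)) (signed (a , σ) (signed⁻¹ (a , σ) y)))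
      ≡⟨ cong (signed⁻¹ (a , σ)) (signed-flip (from i) (signed⁻¹ (a , σ) y)) ⟨
    signed⁻¹ (a , σ) (signed (a , σ) (flip (from i) (signed⁻¹ (a , σ) y)))
      ≡⟨ signed⁻¹-signed (flip (from i) (signed⁻¹ (a , σ) y)) ⟩
    flip (from i) (signed⁻¹ (a , σ) y) ∎

  lookup-signed-zeros : ∀ i → lookup (signed (a , σ) zeros) i ≡ bit (a i)
  lookup-signed-zeros i = begin
    lookup (signed (a , σ) zeros) i    ≡⟨ lookup∘tabulate _ i ⟩
    bit (a i) xor lookup zeros (from i) ≡⟨ cong (bit (a i) xor_) (lookup-replicate (from i) false) ⟩
    bit (a i) xor false                ≡⟨ xor-identityʳ _ ⟩
    bit (a i)                          ∎

  signedAutomorphism : Automorphism (Q n)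
  signedAutomorphism = automorphism {Q n}
    (mk↔ₛ′ (signed (a , σ)) (signed⁻¹ (a , σ)) signed-signed⁻¹ signed⁻¹-signed)
    (λ {x} {y} → flips⇒~ to signed-flip x y)
    (λ {x} {y} → flips⇒~ from signed⁻¹-flip x y)
    where
    flips⇒~ : ∀ {f : Vec Bool n → Vec Bool n} (π : Fin n → Fin n) →
             (∀ i x → f (flip i x) ≡ flip (π i) (f x)) →
             ∀ x y → Graph._~_ (Q n) x y → Graph._~_ (Q n) (f x) (f y)
    flips⇒~ {f} π p x y x~y with ~-flip x y x~y
    ... | i , refl = subst (Graph._~_ (Q n) (f x)) (sym (p i x)) (flip-~ (π i) (f x))

signed-cong : ∀ {g h : Signed n} → g B.≈ h → signed g ≗ signed h
signed-cong {n = n} {a , σ} {b , τ} (p , q) x = tabulate-cong λ i →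
  cong₂ (λ u j → bit u xor lookup x j) (p i) (Group.⁻¹-cong (S n) {σ} {τ} q i)

signed-homo : ∀ (g h : Signed n) → signed (g B.∙ h) ≗ signed g ∘ signed h
signed-homo (a , σ) (b , τ) x = tabulate-cong λ i → begin
  bit (a i ℙ.+ b (σ.from i)) xor lookup x (τ.from (σ.from i))
    ≡⟨ cong (_xor lookup x _) (bit-+ (a i) _) ⟩
  (bit (a i) xor bit (b (σ.from i))) xor lookup x (τ.from (σ.from i))
    ≡⟨ xor-assoc (bit (a i)) _ _ ⟩
  bit (a i) xor (bit (b (σ.from i)) xor lookup x (τ.from (σ.from i)))
    ≡⟨ cong (bit (a i) xor_) (lookup∘tabulate _ (σ.from i)) ⟨
  bit (a i) xor lookup (signed (b , τ) x) (σ.from i) ∎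
  where
  module σ = Inverse σ
  module τ = Inverse τ

-- The image of `zeros` is the translation part, and the images of the edges at `zeros` reveal the
-- permutation.
signed-injective : ∀ {g h : Signed n} → signed g ≗ signed h → g B.≈ h
signed-injective {g = a , σ} {b , τ} p =
    (λ i → bit-injective (trans (sym (lookup-signed-zeros (a , σ) i))
      (trans (cong (λ z → lookup z i) (p zeros)) (lookup-signed-zeros (b , τ) i))))
  , λ i → flip-injective (signed (a , σ) zeros) (begin
      flip (Inverse.to σ i) (signed (a , σ) zeros) ≡⟨ signed-flip (a , σ) i zeros ⟨
      signed (a , σ) (flip i zeros)                ≡⟨ p (flip i zeros) ⟩
      signed (b , τ) (flip i zeros)                ≡⟨ signed-flip (b , τ) i zeros ⟩
      flip (Inverse.to τ i) (signed (b , τ) zeros) ≡⟨ cong (flip (Inverse.to τ i)) (p zeros) ⟨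
      flip (Inverse.to τ i) (signed (a , σ) zeros) ∎)

module EdgeDirections (g : Automorphism (Q n)) where
  open Automorphism g

  private
    flip-image : ∀ x i → ∃[ j ] to (flip i x) ≡ flip j (to x)
    flip-image x i = ~-flip _ _ (Equivalence.to preserves (flip-~ i x))

  direction : Vec Bool n → Fin n → Fin n
  direction x i = proj₁ (flip-image x i)

  to-flip : ∀ x i → to (flip i x) ≡ flip (direction x i) (to x)
  to-flip x i = proj₂ (flip-image x i)

  private
    module P = Inverse perm
    to-injective : ∀ {x y} → to x ≡ to y → x ≡ y
    to-injective p = trans (sym (P.strictlyInverseʳ _)) (trans (cong from p) (P.strictlyInverseʳ _))

    to-flip-flip : ∀ x i j →
                   to (flip i (flip j x)) ≡ flip (direction (flip j x) i) (flip (direction x j) (to x))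
    to-flip-flip x i j = trans (to-flip _ _) (cong (flip _) (to-flip _ _))

  direction-injective : ∀ x {i j} → direction x i ≡ direction x j → i ≡ j
  direction-injective x p = flip-injective x
    (to-injective (trans (to-flip x _) (trans (cong (λ k → flip k (to x)) p) (sym (to-flip x _)))))

  -- The square x, flip i x, flip j x, flip i (flip j x) is mapped to a square, whose
  -- opposite sides have the same direction.
  direction-flip : ∀ x i j → direction (flip j x) i ≡ direction x i
  direction-flip x i j with i ≟ j
  ... | yes refl = sym (flip-injective (to x) (begin
    flip (direction x i) (to x)                                   ≡⟨ flip-involutive d _ ⟨
    flip d (flip d (flip (direction x i) (to x)))                 ≡⟨ cong (flip d) (to-flip-flip x i i) ⟨
    flip d (to (flip i (flip i x)))                               ≡⟨ cong (flip d ∘ to) (flip-involutive i x) ⟩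
    flip d (to x)                                                 ∎))
    where d = direction (flip i x) i
  ... | no i≢j = sym (flip-flip-at
      (begin
        flip (direction (flip i x) j) (flip (direction x i) (to x)) ≡⟨ to-flip-flip x j i ⟨
        to (flip j (flip i x))                                      ≡⟨ cong to (updateAt-commutes j i (≢-sym i≢j) x) ⟩
        to (flip i (flip j x))                                      ≡⟨ to-flip-flip x i j ⟩
        flip (direction (flip j x) i) (flip (direction x j) (to x)) ∎)
      -- The image square is not degenerate: if its first two sides had the same direction, the
      -- image path would return to `to x`, although `flip j (flip i x)` differs from `x`.
      (λ p → i≢j (flip-injective (flip i x) (begin
        flip i (flip i x) ≡⟨ flip-involutive i x ⟩
        x                 ≡⟨ to-injective (begin
            to (flip j (flip i x))                                      ≡⟨ to-flip-flip x j i ⟩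
            flip (direction (flip i x) j) (flip (direction x i) (to x)) ≡⟨ cong (λ k → flip k (flip (direction x i) (to x))) p ⟨
            flip (direction x i) (flip (direction x i) (to x))          ≡⟨ flip-involutive _ (to x) ⟩
            to x                                                        ∎) ⟨
        flip j (flip i x) ∎)))
      (λ p → i≢j (direction-injective x p)))

  direction-constant : ∀ x i → direction x i ≡ direction zeros i
  direction-constant = flip-induction _ (λ _ → refl) (λ j p i → trans (direction-flip _ i j) (p i))

open EdgeDirections

-- Recognises a signed permutation by its effect on edge directions alone. It serves for
-- automorphisms of the hypercube and again for conjugates by `twist`.
signed-unique : ∀ (σ : Fin n ↔ Fin n) (s : Vec Bool n → Vec Bool n) →
                (∀ i x → s (flip i x) ≡ flip (Inverse.to σ i) (s x)) →
                signed (parity ∘ lookup (s zeros) , σ) ≗ s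
signed-unique σ s s-flip = flip-induction _
  (lookup-ext λ i → trans (lookup-signed-zeros g i) (bit-parity _))
  λ i {x} p → begin
    signed g (flip i x)                    ≡⟨ signed-flip g i x ⟩
    flip (Inverse.to σ i) (signed g x)     ≡⟨ cong (flip (Inverse.to σ i)) p ⟩
    flip (Inverse.to σ i) (s x)            ≡⟨ s-flip i x ⟨
    s (flip i x)                           ∎
  where g = parity ∘ lookup (s zeros) , σ

signed-surjective : ∀ (g : Automorphism (Q n)) → ∃[ h ] signed h ≗ Automorphism.to g
signed-surjective {n = n} g = (parity ∘ lookup (g.to zeros) , σ) , signed-unique σ g.to
  λ i x → trans (to-flip g x i) (cong (λ j → flip j (g.to x)) (direction-constant g x i))
  where
  module g = Automorphism g
  module P = Inverse g.perm
  g⁻¹ : Automorphism (Q n)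
  g⁻¹ = Group._⁻¹ (Aut (Q n)) g

  dir dir⁻¹ : Fin n → Fin n
  dir   = direction g zeros
  -- The inverse automorphism walks the image edges back, so its directions at the image of `zeros`
  -- invert `dir`.
  dir⁻¹ = direction g⁻¹ (g.to zeros)

  dir-dir⁻¹ : ∀ i → dir (dir⁻¹ i) ≡ i
  dir-dir⁻¹ i = flip-injective (g.to zeros) (begin
    flip (dir (dir⁻¹ i)) (g.to zeros)                ≡⟨ to-flip g zeros (dir⁻¹ i) ⟨
    g.to (flip (dir⁻¹ i) zeros)                      ≡⟨ cong (g.to ∘ flip (dir⁻¹ i)) (P.strictlyInverseʳ zeros) ⟨
    g.to (flip (dir⁻¹ i) (g.from (g.to zeros)))      ≡⟨ cong g.to (to-flip g⁻¹ (g.to zeros) i) ⟨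
    g.to (g.from (flip i (g.to zeros)))              ≡⟨ P.strictlyInverseˡ _ ⟩
    flip i (g.to zeros)                              ∎)

  dir⁻¹-dir : ∀ i → dir⁻¹ (dir i) ≡ i
  dir⁻¹-dir i = direction-injective g zeros (dir-dir⁻¹ (dir i))

  σ : Fin n ↔ Fin n
  σ = mk↔ₛ′ dir dir⁻¹ dir-dir⁻¹ dir⁻¹-dir

signed≅ : ∀ n → C₂^ n ⋊S ≅ Aut (Q n)
signed≅ n = mk≅ signedAutomorphism
  (λ {g} {h} → signed-cong {g = g} {h}) signed-homo
  (λ {g} {h} → signed-injective {g = g} {h}) signed-surjective

-- The Weyl group acts by signed permutations

sum-single : ∀ (i : Fin n) (f : Fin n → ℤ) → (∀ k → k ≢ i → f k ≡ ℤ.0ℤ) → ∑ℤ.sum f ≡ f i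
sum-single {suc n} zero    f p = trans
  (cong (λ z → f zero ℤ.+ z) (trans (∑ℤ.sum-cong-≗ λ k → p (suc k) λ ()) (∑ℤ.sum-replicate-zero n)))
  (ℤ.+-identityʳ _)
sum-single {suc n} (suc i) f p = trans
  (cong₂ ℤ._+_ (p zero λ ()) (sum-single i (f ∘ suc) λ k k≢i → p (suc k) λ { refl → k≢i refl }))
  (ℤ.+-identityˡ _)

e-same : ∀ (i : Fin n) → e i i ≡ ℤ.1ℤ
e-same i rewrite dec-true (i ≟ i) refl = refl

e-diff : ∀ {i k : Fin n} → i ≢ k → e i k ≡ ℤ.0ℤ
e-diff {i = i} {k} i≢k rewrite dec-false (i ≟ k) i≢k = refl

⟨⟩-e : ∀ (v : Fin n → ℤ) c i → ∑ℤ.sum (λ k → v k ℤ.* (c ℤ.* e i k)) ≡ v i ℤ.* c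
⟨⟩-e v c i = begin
  ∑ℤ.sum (λ k → v k ℤ.* (c ℤ.* e i k))
    ≡⟨ sum-single i _ (λ k k≢i →
         trans (cong (λ z → v k ℤ.* (c ℤ.* z)) (e-diff (≢-sym k≢i))) (zeroʳ (v k) c)) ⟩
  v i ℤ.* (c ℤ.* e i i)
    ≡⟨ cong (v i ℤ.*_) (trans (cong (c ℤ.*_) (e-same i)) (ℤ.*-identityʳ c)) ⟩
  v i ℤ.* c ∎
  where
  zeroʳ : ∀ a c → a ℤ.* (c ℤ.* ℤ.0ℤ) ≡ ℤ.0ℤ
  zeroʳ = ℤ-Solver.solve-∀

signedℤ : Signed n → (Fin n → ℤ) → (Fin n → ℤ)
signedℤ (a , σ) v k = (toSign (a k) ℤ.◃ 1) ℤ.* v (Inverse.from σ k)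

signedℤ-cong : ∀ (g : Signed n) {u v} → u ≗ v → signedℤ g u ≗ signedℤ g v
signedℤ-cong (a , σ) p k = cong ((toSign (a k) ℤ.◃ 1) ℤ.*_) (p _)

signedℤ-homo : ∀ (g h : Signed n) v → signedℤ (g B.∙ h) v ≗ signedℤ g (signedℤ h v)
signedℤ-homo (a , σ) (b , τ) v k = begin
  (toSign (a k ℙ.+ b (σ.from k)) ℤ.◃ 1) ℤ.* v (τ.from (σ.from k))
    ≡⟨ cong (λ s → (s ℤ.◃ 1) ℤ.* v _) (ℙ.+-homo-* (a k) _) ⟩
  ((toSign (a k) Sign.* toSign (b (σ.from k))) ℤ.◃ 1) ℤ.* v (τ.from (σ.from k))
    ≡⟨ cong (ℤ._* v _) (ℤ.◃-distrib-* (toSign (a k)) _ 1 1) ⟩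
  (toSign (a k) ℤ.◃ 1) ℤ.* (toSign (b (σ.from k)) ℤ.◃ 1) ℤ.* v (τ.from (σ.from k))
    ≡⟨ ℤ.*-assoc (toSign (a k) ℤ.◃ 1) _ _ ⟩
  (toSign (a k) ℤ.◃ 1) ℤ.* ((toSign (b (σ.from k)) ℤ.◃ 1) ℤ.* v (τ.from (σ.from k))) ∎
  where
  module σ = Inverse σ
  module τ = Inverse τ

-- One test vector suffices: (1, 2, ..., n) has distinct positive entries, so the sign of an entry
-- of the image gives the translation part and its absolute value the inverse permutation.
signedℤ-faithful : ∀ {g h : Signed n} → (∀ v → signedℤ g v ≗ signedℤ h v) → g B.≈ h
signedℤ-faithful {n = n} {a , σ} {b , τ} p =
    (λ k → ℙ.toSign-injective (proj₁ (compare (p (λ i → ℤ.+ suc (toℕ i)) k))))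
  , Group.⁻¹-cong (S n) {Group._⁻¹ (S n) σ} {Group._⁻¹ (S n) τ}
      λ k → toℕ-injective (proj₂ (compare {toSign (a k)} {toSign (b k)} (p (λ i → ℤ.+ suc (toℕ i)) k)))
  where
  compare : ∀ {s t x y} → (s ℤ.◃ 1) ℤ.* ℤ.+ suc x ≡ (t ℤ.◃ 1) ℤ.* ℤ.+ suc y → s ≡ t × x ≡ y
  compare {Sign.+} {Sign.+} q = refl , ℕ.+-cancelʳ-≡ 0 _ _ (ℕ.suc-injective (ℤ.+-injective q))
  compare {Sign.-} {Sign.-} q = refl , ℕ.+-cancelʳ-≡ 0 _ _ (ℤ.-[1+-injective q)

-- The reflection in ± eᵢ negates coordinate i whatever the sign. The reflection in s eᵢ + t eⱼ
-- sends eᵢ to -st eⱼ and eⱼ to -st eᵢ, hence the common sign `Sign.opposite (s Sign.* t)` on both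
-- exchanged coordinates.
reflection : Root n → Signed n
reflection (short s i)      = (λ k → if does (i ≟ k) then 1ℙ else 0ℙ) , ↔-id _
reflection (long s t i j _) =
  (λ k → if does (i ≟ k) ∨ does (j ≟ k) then fromSign (Sign.opposite (s Sign.* t)) else 0ℙ) ,
  Permutation.transpose i j

module _ {i j : Fin n} where

  transpose-first : Components.transpose i j i ≡ j
  transpose-first rewrite dec-true (i ≟ i) refl = refl

  transpose-second : i ≢ j → Components.transpose i j j ≡ i
  transpose-second i≢j rewrite dec-false (j ≟ i) (≢-sym i≢j) | dec-true (j ≟ j) refl = refl

  transpose-other : ∀ {k} → k ≢ i → k ≢ j → Components.transpose i j k ≡ k
  transpose-other {k} k≢i k≢j rewrite dec-false (k ≟ i) k≢i | dec-false (k ≟ j) k≢j = refl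

reflect-short : ∀ s (i : Fin n) v → reflect (short s i) v ≗ signedℤ (reflection (short s i)) v
reflect-short s i v k = trans (cong (λ z → v k ℤ.- z ℤ.* vector (short s i) k) inner) (cases (i ≟ k))
  where
  σ = s ℤ.◃ 1
  inner : ⟨ v , coroot (short s i) ⟩ ≡ v i ℤ.* (ℤ.+ 2 ℤ.* σ)
  inner = trans
    (∑ℤ.sum-cong-≗ λ k → cong (v k ℤ.*_) (sym (ℤ.*-assoc (ℤ.+ 2) σ (e i k))))
    (⟨⟩-e v (ℤ.+ 2 ℤ.* σ) i)
  other : ∀ x a s → x ℤ.- a ℤ.* (s ℤ.* ℤ.0ℤ) ≡ ℤ.1ℤ ℤ.* x
  other = ℤ-Solver.solve-∀
  -- This depends on σ² = 1, which is not a ring identity, hence one appeal to the solver for each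
  -- sign.
  same : ∀ s x → x ℤ.- x ℤ.* (ℤ.+ 2 ℤ.* (s ℤ.◃ 1)) ℤ.* ((s ℤ.◃ 1) ℤ.* ℤ.1ℤ) ≡ ℤ.-1ℤ ℤ.* x
  same Sign.+ = same₊
    where
    same₊ : ∀ x → x ℤ.- x ℤ.* ℤ.+ 2 ℤ.* ℤ.1ℤ ≡ ℤ.-1ℤ ℤ.* x
    same₊ = ℤ-Solver.solve-∀
  same Sign.- = same₋
    where
    same₋ : ∀ x → x ℤ.- x ℤ.* (ℤ.- ℤ.+ 2) ℤ.* ℤ.-1ℤ ≡ ℤ.-1ℤ ℤ.* x
    same₋ = ℤ-Solver.solve-∀
  cases : Dec (i ≡ k) →
          v k ℤ.- v i ℤ.* (ℤ.+ 2 ℤ.* σ) ℤ.* vector (short s i) k ≡ signedℤ (reflection (short s i)) v k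
  cases (yes refl) rewrite dec-true (i ≟ i) refl = same s (v i)
  cases (no i≢k) rewrite dec-false (i ≟ k) i≢k = other (v k) (v i ℤ.* (ℤ.+ 2 ℤ.* σ)) σ

reflect-long : ∀ s t (i j : Fin n) i≢j v →
               reflect (long s t i j i≢j) v ≗ signedℤ (reflection (long s t i j i≢j)) v
reflect-long s t i j i≢j v k =
  trans (cong (λ z → v k ℤ.- z ℤ.* vector (long s t i j i≢j) k) inner) (cases (i ≟ k) (j ≟ k))
  where
  σ = s ℤ.◃ 1
  τ = t ℤ.◃ 1
  inner : ⟨ v , coroot (long s t i j i≢j) ⟩ ≡ v i ℤ.* σ ℤ.+ v j ℤ.* τ
  inner = begin
    ∑ℤ.sum (λ k → v k ℤ.* (σ ℤ.* e i k ℤ.+ τ ℤ.* e j k))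
      ≡⟨ ∑ℤ.sum-cong-≗ (λ k → ℤ.*-distribˡ-+ (v k) (σ ℤ.* e i k) (τ ℤ.* e j k)) ⟩
    ∑ℤ.sum (λ k → v k ℤ.* (σ ℤ.* e i k) ℤ.+ v k ℤ.* (τ ℤ.* e j k))
      ≡⟨ ∑ℤ.∑-distrib-+ (λ k → v k ℤ.* (σ ℤ.* e i k)) (λ k → v k ℤ.* (τ ℤ.* e j k)) ⟩
    ∑ℤ.sum (λ k → v k ℤ.* (σ ℤ.* e i k)) ℤ.+ ∑ℤ.sum (λ k → v k ℤ.* (τ ℤ.* e j k))
      ≡⟨ cong₂ ℤ._+_ (⟨⟩-e v σ i) (⟨⟩-e v τ j) ⟩
    v i ℤ.* σ ℤ.+ v j ℤ.* τ ∎
  other : ∀ x a s t → x ℤ.- a ℤ.* (s ℤ.* ℤ.0ℤ ℤ.+ t ℤ.* ℤ.0ℤ) ≡ ℤ.1ℤ ℤ.* x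
  other = ℤ-Solver.solve-∀
  swapped : ∀ s t x y → let σ = s ℤ.◃ 1 ; τ = t ℤ.◃ 1 in
    x ℤ.- (x ℤ.* σ ℤ.+ y ℤ.* τ) ℤ.* (σ ℤ.* ℤ.1ℤ ℤ.+ τ ℤ.* ℤ.0ℤ)
    ≡ (toSign (fromSign (Sign.opposite (s Sign.* t))) ℤ.◃ 1) ℤ.* y
  swapped Sign.+ Sign.+ = lemma
    where
    lemma : ∀ x y → x ℤ.- (x ℤ.* ℤ.1ℤ ℤ.+ y ℤ.* ℤ.1ℤ) ℤ.* ℤ.1ℤ ≡ ℤ.-1ℤ ℤ.* y
    lemma = ℤ-Solver.solve-∀
  swapped Sign.+ Sign.- = lemma
    where
    lemma : ∀ x y → x ℤ.- (x ℤ.* ℤ.1ℤ ℤ.+ y ℤ.* ℤ.-1ℤ) ℤ.* ℤ.1ℤ ≡ ℤ.1ℤ ℤ.* y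
    lemma = ℤ-Solver.solve-∀
  swapped Sign.- Sign.+ = lemma
    where
    lemma : ∀ x y → x ℤ.- (x ℤ.* ℤ.-1ℤ ℤ.+ y ℤ.* ℤ.1ℤ) ℤ.* ℤ.-1ℤ ≡ ℤ.1ℤ ℤ.* y
    lemma = ℤ-Solver.solve-∀
  swapped Sign.- Sign.- = lemma
    where
    lemma : ∀ x y → x ℤ.- (x ℤ.* ℤ.-1ℤ ℤ.+ y ℤ.* ℤ.-1ℤ) ℤ.* ℤ.-1ℤ ≡ ℤ.-1ℤ ℤ.* y
    lemma = ℤ-Solver.solve-∀
  swapped′ : ∀ s t x y → let σ = s ℤ.◃ 1 ; τ = t ℤ.◃ 1 in
    y ℤ.- (x ℤ.* σ ℤ.+ y ℤ.* τ) ℤ.* (σ ℤ.* ℤ.0ℤ ℤ.+ τ ℤ.* ℤ.1ℤ)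
    ≡ (toSign (fromSign (Sign.opposite (s Sign.* t))) ℤ.◃ 1) ℤ.* x
  swapped′ s t x y = begin
    y ℤ.- (x ℤ.* (s ℤ.◃ 1) ℤ.+ y ℤ.* (t ℤ.◃ 1)) ℤ.* ((s ℤ.◃ 1) ℤ.* ℤ.0ℤ ℤ.+ (t ℤ.◃ 1) ℤ.* ℤ.1ℤ)
      ≡⟨ comm (s ℤ.◃ 1) (t ℤ.◃ 1) x y ⟩
    y ℤ.- (y ℤ.* (t ℤ.◃ 1) ℤ.+ x ℤ.* (s ℤ.◃ 1)) ℤ.* ((t ℤ.◃ 1) ℤ.* ℤ.1ℤ ℤ.+ (s ℤ.◃ 1) ℤ.* ℤ.0ℤ)
      ≡⟨ swapped t s y x ⟩
    (toSign (fromSign (Sign.opposite (t Sign.* s))) ℤ.◃ 1) ℤ.* x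
      ≡⟨ cong (λ r → (toSign (fromSign (Sign.opposite r)) ℤ.◃ 1) ℤ.* x) (Sign.*-comm t s) ⟩
    (toSign (fromSign (Sign.opposite (s Sign.* t))) ℤ.◃ 1) ℤ.* x ∎
    where
    comm : ∀ σ τ x y → y ℤ.- (x ℤ.* σ ℤ.+ y ℤ.* τ) ℤ.* (σ ℤ.* ℤ.0ℤ ℤ.+ τ ℤ.* ℤ.1ℤ)
                     ≡ y ℤ.- (y ℤ.* τ ℤ.+ x ℤ.* σ) ℤ.* (τ ℤ.* ℤ.1ℤ ℤ.+ σ ℤ.* ℤ.0ℤ)
    comm = ℤ-Solver.solve-∀
  cases : Dec (i ≡ k) → Dec (j ≡ k) →
          v k ℤ.- (v i ℤ.* σ ℤ.+ v j ℤ.* τ) ℤ.* vector (long s t i j i≢j) k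
          ≡ signedℤ (reflection (long s t i j i≢j)) v k
  cases (yes refl) _
    rewrite transpose-second (≢-sym i≢j) | dec-true (i ≟ i) refl | dec-false (j ≟ i) (≢-sym i≢j)
    = swapped s t (v i) (v j)
  cases (no _) (yes refl)
    rewrite transpose-first {i = j} {j = i} | dec-true (j ≟ j) refl | dec-false (i ≟ j) i≢j
    = swapped′ s t (v i) (v j)
  cases (no i≢k) (no j≢k)
    rewrite transpose-other (≢-sym j≢k) (≢-sym i≢k) | dec-false (i ≟ k) i≢k | dec-false (j ≟ k) j≢k
    = other (v k) (v i ℤ.* σ ℤ.+ v j ℤ.* τ) σ τ

reflect-reflection : ∀ (α : Root n) v → reflect α v ≗ signedℤ (reflection α) v
reflect-reflection (short s i)        = reflect-short s i
reflect-reflection (long s t i j i≢j) = reflect-long s t i j i≢j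

word : List (Root n) → Signed n
word []      = B.ε
word (α ∷ w) = reflection α B.∙ word w

act-word : ∀ (w : List (Root n)) v → act w v ≗ signedℤ (word w) v
act-word []      v k = sym (ℤ.*-identityˡ (v k))
act-word (α ∷ w) v k = begin
  reflect α (act w v) k                            ≡⟨ reflect-reflection α (act w v) k ⟩
  signedℤ (reflection α) (act w v) k               ≡⟨ signedℤ-cong (reflection α) (act-word w v) k ⟩
  signedℤ (reflection α) (signedℤ (word w) v) k    ≡⟨ signedℤ-homo (reflection α) (word w) v k ⟨
  signedℤ (reflection α B.∙ word w) v k            ∎

word-cong : ∀ {w w′ : List (Root n)} → Group._≈_ (WeylB n) w w′ → word w B.≈ word w′
word-cong {w = w} {w′} p = signedℤ-faithful {g = word w} {word w′} λ v k →
  trans (sym (act-word w v k)) (trans (p v k) (act-word w′ v k))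

word-injective : ∀ {w w′ : List (Root n)} → word w B.≈ word w′ → Group._≈_ (WeylB n) w w′
word-injective {w = w} {w′} (p , q) v k = begin
  act w v k              ≡⟨ act-word w v k ⟩
  signedℤ (word w) v k   ≡⟨ cong₂ (λ a i → (toSign a ℤ.◃ 1) ℤ.* v i) (p k)
                              (Group.⁻¹-cong (S _) {proj₂ (word w)} {proj₂ (word w′)} q k) ⟩
  signedℤ (word w′) v k  ≡⟨ act-word w′ v k ⟨
  act w′ v k             ∎

word-homo : ∀ (w w′ : List (Root n)) → word (w ++ w′) B.≈ word w B.∙ word w′
word-homo []      w′ = (λ _ → refl) , (λ _ → refl)
word-homo (α ∷ w) w′ =
  B.trans {_} {word (α ∷ w ++ w′)} {reflection α B.∙ (word w B.∙ word w′)} {word (α ∷ w) B.∙ word w′}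
    (B.∙-cong {_} {reflection α} {reflection α} {word (w ++ w′)} {word w B.∙ word w′}
      (B.refl {_} {reflection α}) (word-homo w w′))
    (B.sym {_} {word (α ∷ w) B.∙ word w′} {reflection α B.∙ (word w B.∙ word w′)}
      (B.assoc (reflection α) (word w) (word w′)))

translation : (Fin n → Parity) → Signed n
translation a = a , ↔-id _

-- A short root contributes the translation by one unit vector, so the words are built one flip at a
-- time.
word-translation : ∀ (x : Vec Bool n) → ∃[ w ] word w B.≈ translation (parity ∘ lookup x)
word-translation {n} = flip-induction _
  ([] , (λ i → cong parity (sym (lookup-replicate i false))) , λ _ → refl)
  λ i {x} (w , p , q) → short Sign.+ i ∷ w ,
    (λ k → trans (cong ((if does (i ≟ k) then 1ℙ else 0ℙ) ℙ.+_) (p k))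
      (trans (add (does (i ≟ k)) (lookup x k)) (cong parity (sym (lookup-flip i k x))))) , q
  where
  add : ∀ b c → (if b then 1ℙ else 0ℙ) ℙ.+ parity c ≡ parity (b xor c)
  add false c     = refl
  add true  false = refl
  add true  true  = refl

-- The root eᵢ - eⱼ gives a transposition without signs. A trivial pair has no root and is dropped.
-- `eval` applies the head of the list before the rest, while in a word the last reflection acts
-- before the others, so the root goes to the end.
permutationWord : TranspositionList n → List (Root n)
permutationWord []             = []
permutationWord ((i , j) ∷ xs) with i ≟ j
... | yes _  = permutationWord xs
... | no i≢j = permutationWord xs ++ long Sign.+ Sign.- i j i≢j ∷ []

word-permutation : ∀ (xs : TranspositionList n) → word (permutationWord xs) B.≈ ((λ _ → 0ℙ) , eval xs)
word-permutation []             = (λ _ → refl) , (λ _ → refl)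
word-permutation ((i , j) ∷ xs) with i ≟ j
... | yes refl = p , λ k → trans (q k) (cong (Inverse.to (eval xs)) (sym (transpose-same k)))
  where
  p = proj₁ (word-permutation xs)
  q = proj₂ (word-permutation xs)
  transpose-same : ∀ k → Components.transpose i i k ≡ k
  transpose-same k with k ≟ i
  ... | yes refl = refl
  ... | no k≢i rewrite dec-false (k ≟ i) k≢i = refl
... | no i≢j =
    (λ k → trans (proj₁ h k) (cong₂ ℙ._+_ (p k) (no-sign (does (i ≟ τ k) ∨ does (j ≟ τ k)))))
  , (λ k → trans (proj₂ h k) (q (Components.transpose i j k)))
  where
  p = proj₁ (word-permutation xs)
  q = proj₂ (word-permutation xs)
  τ = Inverse.from (proj₂ (word (permutationWord xs)))
  h = word-homo (permutationWord xs) (long Sign.+ Sign.- i j i≢j ∷ [])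
  no-sign : ∀ b → (if b then 0ℙ else 0ℙ) ℙ.+ 0ℙ ≡ 0ℙ
  no-sign false = refl
  no-sign true  = refl

word-surjective : ∀ (g : Signed n) → ∃[ w ] word w B.≈ g
word-surjective (a , σ) =
  -- Factor `(a , σ)` as the permutation `σ` followed by the translation by `a`.
  w ++ permutationWord (decompose σ) ,
  (λ k → trans (proj₁ h k) (trans (cong₂ ℙ._+_ (trans (p k) (a-bits k)) (proj₁ r _)) (ℙ.+-identityʳ (a k)))) ,
  (λ k → trans (proj₂ h k) (trans (q _) (trans (proj₂ r k) (eval-decompose σ k))))
  where
  x = tabulate (bit ∘ a)
  w = proj₁ (word-translation x)
  p = proj₁ (proj₂ (word-translation x))
  q = proj₂ (proj₂ (word-translation x))
  r = word-permutation (decompose σ)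
  h = word-homo w (permutationWord (decompose σ))
  a-bits : ∀ k → parity (lookup x k) ≡ a k
  a-bits k = bit-injective (trans (bit-parity _) (lookup∘tabulate (bit ∘ a) k))

word≅ : ∀ n → WeylB n ≅ C₂^ n ⋊S
word≅ n = mk≅ word
  (λ {w} {w′} → word-cong {w = w} {w′}) word-homo
  (λ {w} {w′} → word-injective {w = w} {w′}) word-surjective

-- Gray coding

gray : Bool → Bool → ℤ/4
gray false false = 0F
gray true  false = 1F
gray true  true  = 2F
gray false true  = 3F

grayBit : Fin 2 → ℤ/4 → Bool
grayBit 0F 0F = false
grayBit 0F 1F = true
grayBit 0F 2F = true
grayBit 0F 3F = false
grayBit 1F 0F = false
grayBit 1F 1F = false
grayBit 1F 2F = true
grayBit 1F 3F = true

-- A flip of one Gray bit seen in ℤ/4: the reflections t ↦ 1 - t and t ↦ 3 - t of the 4-cycle, each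
-- of which exchanges the ends of two opposite edges.
toggle : Fin 2 → ℤ/4 → ℤ/4
toggle 0F 0F = 1F
toggle 0F 1F = 0F
toggle 0F 2F = 3F
toggle 0F 3F = 2F
toggle 1F 0F = 3F
toggle 1F 1F = 2F
toggle 1F 2F = 1F
toggle 1F 3F = 0F

gray-grayBit : ∀ t → gray (grayBit 0F t) (grayBit 1F t) ≡ t
gray-grayBit 0F = refl
gray-grayBit 1F = refl
gray-grayBit 2F = refl
gray-grayBit 3F = refl

grayBit-gray₀ : ∀ a b → grayBit 0F (gray a b) ≡ a
grayBit-gray₀ false false = refl
grayBit-gray₀ false true  = refl
grayBit-gray₀ true  false = refl
grayBit-gray₀ true  true  = refl

grayBit-gray₁ : ∀ a b → grayBit 1F (gray a b) ≡ b
grayBit-gray₁ false false = refl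
grayBit-gray₁ false true  = refl
grayBit-gray₁ true  false = refl
grayBit-gray₁ true  true  = refl

gray-not₀ : ∀ a b → gray (not a) b ≡ toggle 0F (gray a b)
gray-not₀ false false = refl
gray-not₀ false true  = refl
gray-not₀ true  false = refl
gray-not₀ true  true  = refl

gray-not₁ : ∀ a b → gray a (not b) ≡ toggle 1F (gray a b)
gray-not₁ false false = refl
gray-not₁ false true  = refl
gray-not₁ true  false = refl
gray-not₁ true  true  = refl

gray-antipode : ∀ a b → gray (not a) (not b) ≡ gray a b ⊕ 2F
gray-antipode false false = refl
gray-antipode false true  = refl
gray-antipode true  false = refl
gray-antipode true  true  = refl

toggle-~ : ∀ b t → Graph._~_ C₄ t (toggle b t)
toggle-~ 0F 0F = inj₁ refl
toggle-~ 0F 1F = inj₂ refl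
toggle-~ 0F 2F = inj₁ refl
toggle-~ 0F 3F = inj₂ refl
toggle-~ 1F 0F = inj₂ refl
toggle-~ 1F 1F = inj₁ refl
toggle-~ 1F 2F = inj₂ refl
toggle-~ 1F 3F = inj₁ refl

successor : ∀ t → ∃[ b ] t ⊕ 1F ≡ toggle b t
successor 0F = 0F , refl
successor 1F = 1F , refl
successor 2F = 0F , refl
successor 3F = 1F , refl

predecessor : ∀ t → ∃[ b ] t ≡ toggle b (t ⊕ 1F)
predecessor 0F = 0F , refl
predecessor 1F = 1F , refl
predecessor 2F = 0F , refl
predecessor 3F = 1F , refl

~-toggle : ∀ t u → Graph._~_ C₄ t u → ∃[ b ] u ≡ toggle b t
~-toggle t _ (inj₁ refl) = successor t
~-toggle _ u (inj₂ refl) = predecessor u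

coordinate : Fin 2 → Fin m → Fin (2 * m)
coordinate = combine

coordinate-injectiveˡ : ∀ b (i : Fin m) b′ j → coordinate b i ≡ coordinate b′ j → b ≡ b′
coordinate-injectiveˡ = combine-injectiveˡ

coordinate-injectiveʳ : ∀ b (i : Fin m) b′ j → coordinate b i ≡ coordinate b′ j → i ≡ j
coordinate-injectiveʳ = combine-injectiveʳ

coordinate-surjective : ∀ k → ∃[ b ] ∃[ i ] coordinate {m} b i ≡ k
coordinate-surjective {m} = combine-surjective {2} {m}

position : Vec Bool (2 * m) → Position m
position x = tabulate λ i → gray (lookup x (coordinate 0F i)) (lookup x (coordinate 1F i))

bits : Position m → Vec Bool (2 * m)
bits {m} p = tabulate λ k → let b , i = remQuot m k in grayBit b (lookup p i)

lookup-bits : ∀ (p : Position m) b i → lookup (bits p) (coordinate b i) ≡ grayBit b (lookup p i)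
lookup-bits p b i = trans (lookup∘tabulate _ (coordinate b i))
  (cong (λ (b , i) → grayBit b (lookup p i)) (remQuot-combine b i))

lookup-position : ∀ (x : Vec Bool (2 * m)) i →
                  lookup (position {m} x) i ≡ gray (lookup x (coordinate 0F i)) (lookup x (coordinate 1F i))
lookup-position {m} x i = lookup∘tabulate _ i

position-bits : ∀ (p : Position m) → position (bits p) ≡ p
position-bits p = lookup-ext λ i → begin
  lookup (position (bits p)) i
    ≡⟨ lookup-position (bits p) i ⟩
  gray (lookup (bits p) (coordinate 0F i)) (lookup (bits p) (coordinate 1F i))
    ≡⟨ cong₂ gray (lookup-bits p 0F i) (lookup-bits p 1F i) ⟩
  gray (grayBit 0F (lookup p i)) (grayBit 1F (lookup p i))
    ≡⟨ gray-grayBit _ ⟩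
  lookup p i ∎

bits-position : ∀ (x : Vec Bool (2 * m)) → bits {m} (position x) ≡ x
bits-position {m} x = lookup-ext λ k → helper k (coordinate-surjective {m} k)
  where
  bit-at : ∀ b i → grayBit b (lookup (position x) i) ≡ lookup x (coordinate b i)
  bit-at 0F i = trans (cong (grayBit 0F) (lookup-position {m} x i)) (grayBit-gray₀ _ _)
  bit-at 1F i = trans (cong (grayBit 1F) (lookup-position {m} x i)) (grayBit-gray₁ _ _)
  helper : ∀ k → (∃[ b ] ∃[ i ] coordinate b i ≡ k) → lookup (bits {m} (position x)) k ≡ lookup x k
  helper _ (b , i , refl) = trans (lookup-bits (position x) b i) (bit-at b i)

position-flip : ∀ b i (x : Vec Bool (2 * m)) →
                position {m} (flip (coordinate b i) x) ≡ position x [ i ]%= toggle b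
position-flip {m} b i x = lookup-ext eq
  where
  at : ∀ b → gray (lookup (flip (coordinate b i) x) (coordinate 0F i))
                  (lookup (flip (coordinate b i) x) (coordinate 1F i))
           ≡ toggle b (gray (lookup x (coordinate 0F i)) (lookup x (coordinate 1F i)))
  at 0F = trans (cong₂ gray (lookup∘updateAt (coordinate 0F i) x)
    (lookup∘updateAt′ (coordinate 1F i) (coordinate 0F i)
      (λ p → contradiction (coordinate-injectiveˡ 1F i 0F i p) λ ()) x)) (gray-not₀ _ _)
  at 1F = trans (cong₂ gray
    (lookup∘updateAt′ (coordinate 0F i) (coordinate 1F i)
      (λ p → contradiction (coordinate-injectiveˡ 0F i 1F i p) λ ()) x)
    (lookup∘updateAt (coordinate 1F i) x)) (gray-not₁ _ _)
  eq : lookup (position {m} (flip (coordinate b i) x)) ≗ lookup (position x [ i ]%= toggle b)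
  eq j with j ≟ i
  ... | yes refl = begin
    lookup (position {m} (flip (coordinate b i) x)) i ≡⟨ lookup-position {m} (flip (coordinate b i) x) i ⟩
    _                                          ≡⟨ at b ⟩
    _                                          ≡⟨ cong (toggle b) (lookup-position {m} x i) ⟨
    toggle b (lookup (position x) i)           ≡⟨ lookup∘updateAt i (position x) ⟨
    lookup (position x [ i ]%= toggle b) i     ∎
  ... | no j≢i = begin
    lookup (position {m} (flip (coordinate b i) x)) j ≡⟨ lookup-position {m} (flip (coordinate b i) x) j ⟩
    _                                          ≡⟨ cong₂ gray (away 0F) (away 1F) ⟩
    _                                          ≡⟨ lookup-position {m} x j ⟨
    lookup (position x) j                      ≡⟨ lookup∘updateAt′ j i j≢i (position x) ⟨
    lookup (position x [ i ]%= toggle b) j     ∎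
    where
    away : ∀ b′ → lookup (flip (coordinate b i) x) (coordinate b′ j) ≡ lookup x (coordinate b′ j)
    away b′ = lookup∘updateAt′ _ _ (λ p → j≢i (coordinate-injectiveʳ b′ j b i p)) x

position-injective : ∀ (x y : Vec Bool (2 * m)) → position {m} x ≡ position y → x ≡ y
position-injective {m} x y p = trans (sym (bits-position {m} x)) (trans (cong bits p) (bits-position {m} y))

antipode : Position m → Position m
antipode = map (_⊕ 2F)

position-negate : ∀ (x : Vec Bool (2 * m)) → position {m} (negate x) ≡ antipode (position {m} x)
position-negate {m} x = lookup-ext λ i → begin
  lookup (position {m} (negate x)) i
    ≡⟨ lookup-position {m} (negate x) i ⟩
  gray (lookup (negate x) (coordinate 0F i)) (lookup (negate x) (coordinate 1F i))
    ≡⟨ cong₂ gray (lookup-map (coordinate 0F i) not x) (lookup-map (coordinate 1F i) not x) ⟩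
  gray (not (lookup x (coordinate 0F i))) (not (lookup x (coordinate 1F i)))
    ≡⟨ gray-antipode _ _ ⟩
  gray (lookup x (coordinate 0F i)) (lookup x (coordinate 1F i)) ⊕ 2F
    ≡⟨ cong (_⊕ 2F) (lookup-position x i) ⟨
  lookup (position {m} x) i ⊕ 2F
    ≡⟨ lookup-map i (_⊕ 2F) (position {m} x) ⟨
  lookup (antipode (position {m} x)) i ∎

position↔ : Vec Bool (2 * m) ↔ Position m
position↔ {m} = mk↔ₛ′ position bits position-bits (bits-position {m})

updateAt-~ : ∀ b i (p : Position m) → Graph._~_ (C₄^ m) p (p [ i ]%= toggle b)
updateAt-~ b i p = i
  , subst (Graph._~_ C₄ (lookup p i)) (sym (lookup∘updateAt i p)) (toggle-~ b _)
  , λ j j≢i → sym (lookup∘updateAt′ j i j≢i p)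

position-~ : ∀ {x y : Vec Bool (2 * m)} →
             Graph._~_ (Q (2 * m)) x y ⇔ Graph._~_ (C₄^ m) (position x) (position y)
position-~ {m} {x} {y} = mk⇔ forward backward
  where
  forward : Graph._~_ (Q (2 * m)) x y → Graph._~_ (C₄^ m) (position x) (position y)
  forward x~y with ~-flip x y x~y
  ... | k , refl with coordinate-surjective {m} k
  ... | b , i , refl = subst (Graph._~_ (C₄^ m) (position x))
    {position x [ i ]%= toggle b} {position {m} (flip (coordinate b i) x)}
    (sym (position-flip {m} b i x)) (updateAt-~ b i (position x))

  backward : Graph._~_ (C₄^ m) (position x) (position y) → Graph._~_ (Q (2 * m)) x y
  backward (i , adjacent , same) with ~-toggle (lookup (position x) i) (lookup (position y) i) adjacent
  ... | b , p = subst (Graph._~_ (Q (2 * m)) x)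
    (position-injective {m} (flip (coordinate b i) x) y
      (trans (position-flip {m} b i x)
        (lookup-ext {x = position x [ i ]%= toggle b} {position y} eq)))
    (flip-~ (coordinate b i) x)
    where
    eq : lookup (position x [ i ]%= toggle b) ≗ lookup (position y)
    eq j with j ≟ i
    ... | yes refl = trans (lookup∘updateAt i (position x)) (sym p)
    ... | no j≢i = trans (lookup∘updateAt′ j i j≢i (position x)) (same j j≢i)

hypercube≅ : ∀ m → Aut (Q (2 * m)) ≅ Aut (C₄^ m)
hypercube≅ m = conjugate {Q (2 * m)} {C₄^ m} position↔ (λ {x} {y} → position-~ {m} {x} {y})

-- Most-perfect arrays as functions on the hypercube graph

record Perfect (E : Vec Bool n → ℕ) : Set where
  field
    antipodal-sum : ℕ
    antipodal     : ∀ x → E x + E (negate x) ≡ antipodal-sum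
    face          : ∀ {k l} → k ≢ l → ∀ x →
      E x + E (flip k x) + E (flip l x) + E (flip k (flip l x)) ≡ 2 * antipodal-sum

pandiagonal-antipode : ∀ (p : Position m) d t → pandiagonal p d (t ⊕ 2F) ≡ antipode (pandiagonal p d t)
pandiagonal-antipode p d t = lookup-ext λ i → begin
  lookup (pandiagonal p d (t ⊕ 2F)) i
    ≡⟨ lookup-zipWith _ i p d ⟩
  lookup p i ⊕ (t ⊕ 2F) ⊙ lookup d i
    ≡⟨ shift (lookup d i) (lookup p i) t ⟩
  lookup p i ⊕ t ⊙ lookup d i ⊕ 2F
    ≡⟨ cong (_⊕ 2F) (lookup-zipWith _ i p d) ⟨
  lookup (pandiagonal p d t) i ⊕ 2F
    ≡⟨ lookup-map i (_⊕ 2F) (pandiagonal p d t) ⟨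
  lookup (antipode (pandiagonal p d t)) i ∎
  where
  shift : ∀ s a t → a ⊕ (t ⊕ 2F) ⊙ s ≡ a ⊕ t ⊙ s ⊕ 2F
  shift Sign.+ = toWitness {a? = all? λ a → all? λ t → a ⊕ (t ⊕ 2F) ≟ a ⊕ t ⊕ 2F} _
  shift Sign.- = toWitness {a? = all? λ a → all? λ t → a ⊕ (t ⊕ 2F) ⊙ Sign.- ≟ a ⊕ t ⊙ Sign.- ⊕ 2F} _

-- Every position lies on some pandiagonal, so that `half-sum` becomes a statement about all
-- antipodal pairs.
pandiagonal-start : ∀ (p : Position m) → pandiagonal p (replicate m Sign.+) 0F ≡ p
pandiagonal-start p = lookup-ext λ i → begin
  lookup (pandiagonal p (replicate _ Sign.+) 0F) i ≡⟨ lookup-zipWith _ i p (replicate _ Sign.+) ⟩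
  lookup p i ⊕ 0F ⊙ lookup (replicate _ Sign.+) i  ≡⟨ cong (λ s → lookup p i ⊕ 0F ⊙ s) (lookup-replicate i Sign.+) ⟩
  lookup p i ⊕ 0F                                  ≡⟨ ⊕-identityʳ (lookup p i) ⟩
  lookup p i                                       ∎
  where
  ⊕-identityʳ : ∀ a → a ⊕ 0F ≡ a
  ⊕-identityʳ = toWitness {a? = all? λ a → a ⊕ 0F ≟ a} _

toggle-line₀₁ : ∀ t (f : ℤ/4 → ℕ) →
                f t + f (toggle 0F t) + f (toggle 1F t) + f (toggle 0F (toggle 1F t)) ≡ sum₄ f
toggle-line₀₁ 0F f = reorder (f 0F) (f 1F) (f 2F) (f 3F)
  where
  reorder : ∀ a b c d → a + b + d + c ≡ a + b + c + d
  reorder = solve-∀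
toggle-line₀₁ 1F f = reorder (f 0F) (f 1F) (f 2F) (f 3F)
  where
  reorder : ∀ a b c d → b + a + c + d ≡ a + b + c + d
  reorder = solve-∀
toggle-line₀₁ 2F f = reorder (f 0F) (f 1F) (f 2F) (f 3F)
  where
  reorder : ∀ a b c d → c + d + b + a ≡ a + b + c + d
  reorder = solve-∀
toggle-line₀₁ 3F f = reorder (f 0F) (f 1F) (f 2F) (f 3F)
  where
  reorder : ∀ a b c d → d + c + a + b ≡ a + b + c + d
  reorder = solve-∀

toggle-line : ∀ b b′ → b ≢ b′ → ∀ t (f : ℤ/4 → ℕ) →
              f t + f (toggle b t) + f (toggle b′ t) + f (toggle b (toggle b′ t)) ≡ sum₄ f
toggle-line 0F 0F p = contradiction refl p
toggle-line 1F 1F p = contradiction refl p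
toggle-line 0F 1F p t f = toggle-line₀₁ t f
toggle-line 1F 0F p t f = begin
  f t + f (toggle 1F t) + f (toggle 0F t) + f (toggle 1F (toggle 0F t))
    ≡⟨ cong (λ u → f t + f (toggle 1F t) + f (toggle 0F t) + f u) (toggle-comm t) ⟩
  f t + f (toggle 1F t) + f (toggle 0F t) + f (toggle 0F (toggle 1F t))
    ≡⟨ reorder (f t) (f (toggle 1F t)) (f (toggle 0F t)) _ ⟩
  f t + f (toggle 0F t) + f (toggle 1F t) + f (toggle 0F (toggle 1F t))
    ≡⟨ toggle-line₀₁ t f ⟩
  sum₄ f ∎
  where
  toggle-comm : ∀ t → toggle 1F (toggle 0F t) ≡ toggle 0F (toggle 1F t)
  toggle-comm 0F = refl
  toggle-comm 1F = refl
  toggle-comm 2F = refl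
  toggle-comm 3F = refl
  reorder : ∀ a b c d → a + b + c + d ≡ a + c + b + d
  reorder = solve-∀

-- A face may be entered at any of its vertices, but `subsquare-sum` names a subsquare by the corner
-- from which both coordinates step forward; `u` is that end of the edge.
toggle-pair : ∀ b t → ∃[ u ] ((f : ℤ/4 → ℕ) → f t + f (toggle b t) ≡ f u + f (u ⊕ 1F))
toggle-pair 0F 0F = 0F , λ f → refl
toggle-pair 0F 1F = 0F , λ f → ℕ.+-comm (f 1F) (f 0F)
toggle-pair 0F 2F = 2F , λ f → refl
toggle-pair 0F 3F = 2F , λ f → ℕ.+-comm (f 3F) (f 2F)
toggle-pair 1F 0F = 3F , λ f → ℕ.+-comm (f 0F) (f 3F)
toggle-pair 1F 1F = 1F , λ f → refl
toggle-pair 1F 2F = 1F , λ f → ℕ.+-comm (f 2F) (f 1F)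
toggle-pair 1F 3F = 3F , λ f → refl

module _ {A : Set} {f : A → A} where

  %=⇒≔ : ∀ i (x : Vec A n) → x [ i ]%= f ≡ x [ i ]≔ f (lookup x i)
  %=⇒≔ i x = updateAt-cong-local i x refl

  ≔-%= : ∀ i (x : Vec A n) {t} → (x [ i ]≔ t) [ i ]%= f ≡ x [ i ]≔ f t
  ≔-%= i x = updateAt-updateAt-local i x refl

  %=-%=⇒≔-≔ : ∀ {g : A → A} {i j} → i ≢ j → (x : Vec A n) →
               (x [ i ]%= f) [ j ]%= g ≡ (x [ i ]≔ f (lookup x i)) [ j ]≔ g (lookup x j)
  %=-%=⇒≔-≔ {g = g} {i} {j} i≢j x = trans
    (updateAt-cong-local j _ (cong g (lookup∘updateAt′ j i (≢-sym i≢j) x)))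
    (cong (_[ j ]≔ g (lookup x j)) (%=⇒≔ i x))

module _ {E : Position m → ℕ} where

  mostPerfect⇒perfect : IsMostPerfect E → Perfect (E ∘ position {m})
  mostPerfect⇒perfect E-perfect = record
    { antipodal-sum = c
    ; antipodal     = λ x → ℕ.*-cancelˡ-≡ _ _ 2 (trans (trans
        (cong (λ q → 2 * (E (position x) + E q)) (position-negate {m} x)) (half (position x))) (sym (half p₀)))
    ; face          = λ {k} {l} → face k l (coordinate-surjective {m} k) (coordinate-surjective {m} l)
    }
    where
    open IsMostPerfect E-perfect
    half : ∀ p → 2 * (E p + E (antipode p)) ≡ magicConstant
    half p = begin
      2 * (E p + E (antipode p))
        ≡⟨ cong (λ q → 2 * (E q + E (antipode q))) (pandiagonal-start p) ⟨
      2 * (E (pan 0F) + E (antipode (pan 0F)))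
        ≡⟨ cong (λ q → 2 * (E (pan 0F) + E q)) (pandiagonal-antipode p d 0F) ⟨
      2 * (E (pan 0F) + E (pan 2F))
        ≡⟨ half-sum p d 0F ⟩
      magicConstant ∎
      where
      d = replicate m Sign.+
      pan = pandiagonal p d
    p₀ = replicate m 0F
    -- The axioms fix only the double of an antipodal sum; reading it off at one position avoids
    -- halving the magic constant.
    c = E p₀ + E (antipode p₀)

    line-face : ∀ {b b′} → b ≢ b′ → ∀ i p →
      E p + E (p [ i ]%= toggle b) + E (p [ i ]%= toggle b′) + E ((p [ i ]%= toggle b′) [ i ]%= toggle b)
        ≡ magicConstant
    line-face {b} {b′} b≢b′ i p = begin
      E p + E (p [ i ]%= toggle b) + E (p [ i ]%= toggle b′) + E ((p [ i ]%= toggle b′) [ i ]%= toggle b)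
        ≡⟨ cong₂ _+_ (cong₂ _+_ (cong₂ _+_ (cong E (sym ([]≔-lookup p i)))
             (cong E (%=⇒≔ i p))) (cong E (%=⇒≔ i p)))
             (cong E (trans (updateAt-updateAt i p) (%=⇒≔ i p))) ⟩
      f t + f (toggle b t) + f (toggle b′ t) + f (toggle b (toggle b′ t))
        ≡⟨ toggle-line b b′ b≢b′ t f ⟩
      sum₄ f
        ≡⟨ line-sum i p ⟩
      magicConstant ∎
      where
      t = lookup p i
      f = λ u → E (p [ i ]≔ u)

    square-face : ∀ {i j} → i ≢ j → ∀ b b′ p →
      E p + E (p [ i ]%= toggle b) + E (p [ j ]%= toggle b′) + E ((p [ j ]%= toggle b′) [ i ]%= toggle b)
        ≡ magicConstant
    square-face {i} {j} i≢j b b′ p = begin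
      E p + E (p [ i ]%= toggle b) + E (p [ j ]%= toggle b′) + E ((p [ j ]%= toggle b′) [ i ]%= toggle b)
        ≡⟨ cong₂ _+_ (cong₂ _+_ (cong₂ _+_
             (cong E (sym (trans (cong (_[ j ]≔ u) ([]≔-lookup p i)) ([]≔-lookup p j))))
             (cong E (trans (sym (updateAt-id j _)) (%=-%=⇒≔-≔ i≢j p))))
             (cong E (trans (cong (_[ j ]%= toggle b′) (sym (updateAt-id i p))) (%=-%=⇒≔-≔ i≢j p))))
             (cong E (trans (updateAt-commutes i j i≢j p) (%=-%=⇒≔-≔ i≢j p))) ⟩
      f t u + f (toggle b t) u + f t (toggle b′ u) + f (toggle b t) (toggle b′ u)
        ≡⟨ ℕ.+-assoc (f t u + f (toggle b t) u) _ _ ⟩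
      (f t u + f (toggle b t) u) + (f t (toggle b′ u) + f (toggle b t) (toggle b′ u))
        ≡⟨ cong₂ _+_ (tp (λ t → f t u)) (tp (λ t → f t (toggle b′ u))) ⟩
      (f t₀ u + f (t₀ ⊕ 1F) u) + (f t₀ (toggle b′ u) + f (t₀ ⊕ 1F) (toggle b′ u))
        ≡⟨ regroup (f t₀ u) _ _ _ ⟩
      (f t₀ u + f t₀ (toggle b′ u)) + (f (t₀ ⊕ 1F) u + f (t₀ ⊕ 1F) (toggle b′ u))
        ≡⟨ cong₂ _+_ (up (f t₀)) (up (f (t₀ ⊕ 1F))) ⟩
      (f t₀ u₀ + f t₀ (u₀ ⊕ 1F)) + (f (t₀ ⊕ 1F) u₀ + f (t₀ ⊕ 1F) (u₀ ⊕ 1F))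
        ≡⟨ ℕ.+-assoc (f t₀ u₀ + f t₀ (u₀ ⊕ 1F)) _ _ ⟨
      f t₀ u₀ + f t₀ (u₀ ⊕ 1F) + f (t₀ ⊕ 1F) u₀ + f (t₀ ⊕ 1F) (u₀ ⊕ 1F)
        ≡⟨ subsquare-sum i≢j p t₀ u₀ ⟩
      magicConstant ∎
      where
      t = lookup p i
      u = lookup p j
      f = λ x y → E ((p [ i ]≔ x) [ j ]≔ y)
      t₀ = proj₁ (toggle-pair b t)
      tp = proj₂ (toggle-pair b t)
      u₀ = proj₁ (toggle-pair b′ u)
      up = proj₂ (toggle-pair b′ u)
      regroup : ∀ a b c d → (a + b) + (c + d) ≡ (a + c) + (b + d)
      regroup = solve-∀

    -- Two distinct bits belong either to one coordinate, and the face is a line, or to two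
    -- coordinates, and the face is a subsquare.
    position-face : ∀ b i b′ j → coordinate {m} b i ≢ coordinate b′ j → ∀ p →
      E p + E (p [ i ]%= toggle b) + E (p [ j ]%= toggle b′) + E ((p [ j ]%= toggle b′) [ i ]%= toggle b)
        ≡ magicConstant
    position-face b i b′ j k≢l p with i ≟ j
    ... | yes refl = line-face (λ b≡b′ → k≢l (cong (λ b → coordinate b i) b≡b′)) i p
    ... | no i≢j   = square-face i≢j b b′ p

    face : ∀ k l → (∃[ b ] ∃[ i ] coordinate {m} b i ≡ k) → (∃[ b ] ∃[ i ] coordinate {m} b i ≡ l) →
           k ≢ l → ∀ x → E (position {m} x) + E (position {m} (flip k x)) + E (position {m} (flip l x))
             + E (position {m} (flip k (flip l x))) ≡ 2 * c
    face k l (b , i , refl) (b′ , j , refl) k≢l x = begin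
      E p + E (position {m} (flip k x)) + E (position {m} (flip l x)) + E (position {m} (flip k (flip l x)))
        ≡⟨ cong₂ _+_ (cong₂ _+_ (cong (E p +_) (cong E (position-flip b i x))) (cong E (position-flip b′ j x)))
             (cong E (trans (position-flip b i (flip l x)) (cong (_[ i ]%= toggle b) (position-flip b′ j x)))) ⟩
      E p + E (p [ i ]%= toggle b) + E (p [ j ]%= toggle b′) + E ((p [ j ]%= toggle b′) [ i ]%= toggle b)
        ≡⟨ position-face b i b′ j k≢l p ⟩
      magicConstant
        ≡⟨ half p₀ ⟨
      2 * c ∎
      where p = position {m} x

  perfect⇒mostPerfect : Perfect (E ∘ position {m}) → IsMostPerfect E
  perfect⇒mostPerfect E-perfect = record
    { magicConstant   = 2 * c
    ; line-sum        = line-sum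
    ; subsquare-sum   = subsquare-sum
    -- The four positions split into the antipodal pairs at t = 0, 2 and at t = 1, 3.
    ; pandiagonal-sum = λ p d → trans (regroup (E (pandiagonal p d 0F)) _ _ _)
        (cong₂ _+_ (half p d 0F) (trans (half p d 1F) (sym (ℕ.+-identityʳ c))))
    ; half-sum        = λ p d t → cong (2 *_) (half p d t)
    }
    where
    open Perfect E-perfect renaming (antipodal-sum to c)
    regroup : ∀ a b c d → a + b + c + d ≡ (a + c) + (b + d)
    regroup = solve-∀

    half : ∀ p d t → E (pandiagonal p d t) + E (pandiagonal p d (t ⊕ 2F)) ≡ c
    half p d t = begin
      E q + E (pandiagonal p d (t ⊕ 2F))           ≡⟨ cong (λ r → E q + E r) (pandiagonal-antipode p d t) ⟩
      E q + E (antipode q)                         ≡⟨ cong (λ r → E r + E (antipode r)) (position-bits q) ⟨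
      E (position {m} x) + E (antipode (position {m} x)) ≡⟨ cong (λ r → E (position {m} x) + E r)
                                                              (position-negate {m} x) ⟨
      E (position {m} x) + E (position {m} (negate x))  ≡⟨ antipodal x ⟩
      c                                            ∎
      where
      q = pandiagonal p d t
      x = bits q

    position-face : ∀ b i b′ j → coordinate {m} b i ≢ coordinate b′ j → ∀ p →
      E p + E (p [ i ]%= toggle b) + E (p [ j ]%= toggle b′) + E ((p [ j ]%= toggle b′) [ i ]%= toggle b)
        ≡ 2 * c
    position-face b i b′ j k≢l p = subst (λ p →
        E p + E (p [ i ]%= toggle b) + E (p [ j ]%= toggle b′) + E ((p [ j ]%= toggle b′) [ i ]%= toggle b)
          ≡ 2 * c)
      (position-bits p)
      (trans (sym (cong₂ _+_ (cong₂ _+_ (cong (E _ +_)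
               (cong E (position-flip b i x))) (cong E (position-flip b′ j x)))
               (cong E (trans (position-flip b i (flip (coordinate b′ j) x))
                 (cong (_[ i ]%= toggle b) (position-flip b′ j x))))))
        (face k≢l x))
      where x = bits p

    line-sum : ∀ i p → sum₄ (λ t → E (p [ i ]≔ t)) ≡ 2 * c
    line-sum i p = begin
      sum₄ f
        ≡⟨ toggle-line 0F 1F (λ ()) 0F f ⟨
      f 0F + f 1F + f 3F + f 2F
        ≡⟨ cong₂ _+_ (cong₂ _+_ (cong (f 0F +_) (cong E (≔-%= i p))) (cong E (≔-%= i p)))
             (cong E (trans (cong (_[ i ]%= toggle 0F) (≔-%= i p)) (≔-%= i p))) ⟨
      E q + E (q [ i ]%= toggle 0F) + E (q [ i ]%= toggle 1F) + E ((q [ i ]%= toggle 1F) [ i ]%= toggle 0F)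
        ≡⟨ position-face 0F i 1F i (λ k≡l → contradiction (coordinate-injectiveˡ 0F i 1F i k≡l) λ ()) q ⟩
      2 * c ∎
      where
      f = λ t → E (p [ i ]≔ t)
      q = p [ i ]≔ 0F

    subsquare-sum : ∀ {i j} → i ≢ j → ∀ p a b →
      let square = λ x y → E ((p [ i ]≔ x) [ j ]≔ y) in
      square a b + square a (b ⊕ 1F) + square (a ⊕ 1F) b + square (a ⊕ 1F) (b ⊕ 1F) ≡ 2 * c
    -- A step forward in ℤ/4 flips one Gray bit; which one depends on the starting point.
    subsquare-sum {i} {j} i≢j p a b with successor a | successor b
    ... | s , a⊕1≡ | s′ , b⊕1≡ rewrite a⊕1≡ | b⊕1≡ = begin
      f a b + f a (toggle s′ b) + f (toggle s a) b + f (toggle s a) (toggle s′ b)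
        ≡⟨ regroup′ (f a b) _ _ _ ⟩
      f a b + f (toggle s a) b + f a (toggle s′ b) + f (toggle s a) (toggle s′ b)
        ≡⟨ cong₂ _+_ (cong₂ _+_ (cong (f a b +_) (cong E (toggle-i b))) (cong E (≔-%= j _)))
             (cong E (trans (cong (_[ i ]%= toggle s) (≔-%= j _)) (toggle-i (toggle s′ b)))) ⟨
      E q + E (q [ i ]%= toggle s) + E (q [ j ]%= toggle s′) + E ((q [ j ]%= toggle s′) [ i ]%= toggle s)
        ≡⟨ position-face s i s′ j (λ k≡l → i≢j (coordinate-injectiveʳ s i s′ j k≡l)) q ⟩
      2 * c ∎
      where
      f = λ x y → E ((p [ i ]≔ x) [ j ]≔ y)
      q = (p [ i ]≔ a) [ j ]≔ b
      toggle-i : ∀ y → ((p [ i ]≔ a) [ j ]≔ y) [ i ]%= toggle s ≡ (p [ i ]≔ toggle s a) [ j ]≔ y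
      toggle-i y = trans (updateAt-commutes i j i≢j (p [ i ]≔ a)) (cong (_[ j ]≔ y) (≔-%= i p))
      regroup′ : ∀ a b c d → a + b + c + d ≡ a + c + b + d
      regroup′ = solve-∀

-- Affine functions on the hypercube

isOdd : Vec Bool n → Bool
isOdd []      = false
isOdd (b ∷ x) = b xor isOdd x

isOdd-flip : ∀ i (x : Vec Bool n) → isOdd (flip i x) ≡ not (isOdd x)
isOdd-flip zero    (b ∷ x) = sym (not-distribˡ-xor b (isOdd x))
isOdd-flip (suc i) (b ∷ x) = trans (cong (b xor_) (isOdd-flip i x)) (sym (not-distribʳ-xor b (isOdd x)))

isOdd-negate : ∀ (x : Vec Bool n) → isOdd (negate x) ≡ isOdd (replicate n true) xor isOdd x
isOdd-negate []      = refl
isOdd-negate {suc n} (b ∷ x) = trans (cong (not b xor_) (isOdd-negate x))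
  (swap b (isOdd (replicate n true)) (isOdd x))
  where
  swap : ∀ a b c → not a xor (b xor c) ≡ not b xor (a xor c)
  swap false b c = not-distribˡ-xor b c
  swap true  b c = sym (xor-annihilates-not b c)

isOdd-ones : ∀ m → isOdd (replicate (2 * m) true) ≡ false
isOdd-ones m = trans (ones-+ m (m + 0)) (trans
  (cong (λ k → isOdd (replicate m true) xor isOdd (replicate k true)) (ℕ.+-identityʳ m))
  (xor-same (isOdd (replicate m true))))
  where
  ones-+ : ∀ m n → isOdd (replicate (m + n) true) ≡ isOdd (replicate m true) xor isOdd (replicate n true)
  ones-+ zero    n = refl
  ones-+ (suc m) n = trans (cong not (ones-+ m n)) (not-distribˡ-xor (isOdd (replicate m true)) _)

twist : Vec Bool n → Vec Bool n
twist x = map (isOdd x xor_) x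

-- A flip changes the parity, so the all-ones term of `twist` appears or disappears on top of it.
twist-flip : ∀ i (x : Vec Bool n) → twist (flip i x) ≡ negate (flip i (twist x))
twist-flip i x = lookup-ext λ j → begin
  lookup (twist (flip i x)) j
    ≡⟨ lookup-map j _ (flip i x) ⟩
  isOdd (flip i x) xor lookup (flip i x) j
    ≡⟨ cong₂ _xor_ (isOdd-flip i x) (lookup-flip i j x) ⟩
  not (isOdd x) xor (does (i ≟ j) xor lookup x j)
    ≡⟨ swap (isOdd x) (does (i ≟ j)) (lookup x j) ⟩
  not (does (i ≟ j) xor (isOdd x xor lookup x j))
    ≡⟨ cong (λ z → not (does (i ≟ j) xor z)) (lookup-map j (isOdd x xor_) x) ⟨
  not (does (i ≟ j) xor lookup (twist x) j)
    ≡⟨ cong not (lookup-flip i j (twist x)) ⟨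
  not (lookup (flip i (twist x)) j)
    ≡⟨ lookup-map j not (flip i (twist x)) ⟨
  lookup (negate (flip i (twist x))) j ∎
  where
  swap : ∀ a b c → not a xor (b xor c) ≡ not (b xor (a xor c))
  swap false b c = refl
  swap true  b c = trans (sym (not-involutive _)) (cong not (not-distribʳ-xor b c))

twist-flip-flip : ∀ i j (x : Vec Bool n) → twist (flip i (flip j x)) ≡ flip i (flip j (twist x))
twist-flip-flip i j x = begin
  twist (flip i (flip j x))                    ≡⟨ twist-flip i (flip j x) ⟩
  negate (flip i (twist (flip j x)))           ≡⟨ cong (negate ∘ flip i) (twist-flip j x) ⟩
  negate (flip i (negate (flip j (twist x))))  ≡⟨ negate-flip i _ ⟩
  flip i (negate (negate (flip j (twist x))))  ≡⟨ cong (flip i) (negate-involutive (flip j (twist x))) ⟩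
  flip i (flip j (twist x))                    ∎

module Twist (n-even : isOdd (replicate n true) ≡ false) where

  isOdd-negate-even : ∀ (x : Vec Bool n) → isOdd (negate x) ≡ isOdd x
  isOdd-negate-even x = trans (isOdd-negate x) (cong (_xor isOdd x) n-even)

  -- The all-ones vector has even weight, so adding it keeps the parity. A second twist then adds
  -- the same multiple of it and cancels the first.
  isOdd-twist : ∀ (x : Vec Bool n) → isOdd (twist x) ≡ isOdd x
  isOdd-twist x = by (isOdd x)
    where
    by : ∀ b → isOdd (map (b xor_) x) ≡ isOdd x
    by false = cong isOdd (map-id x)
    by true  = isOdd-negate-even x

  twist-involutive : ∀ (x : Vec Bool n) → twist (twist x) ≡ x
  twist-involutive x = begin
    map (isOdd (twist x) xor_) (twist x)   ≡⟨ cong (λ b → map (b xor_) (twist x)) (isOdd-twist x) ⟩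
    map (isOdd x xor_) (map (isOdd x xor_) x) ≡⟨ map-∘ _ _ x ⟨
    map ((isOdd x xor_) ∘ (isOdd x xor_)) x   ≡⟨ map-cong (xor-cancelˡ (isOdd x)) x ⟩
    map id x                                  ≡⟨ map-id x ⟩
    x                                         ∎

  twist-negate : ∀ (x : Vec Bool n) → twist (negate x) ≡ negate (twist x)
  twist-negate x = begin
    map (isOdd (negate x) xor_) (negate x) ≡⟨ cong (λ b → map (b xor_) (negate x)) (isOdd-negate-even x) ⟩
    map (isOdd x xor_) (map not x)         ≡⟨ map-∘ _ _ x ⟨
    map ((isOdd x xor_) ∘ not) x           ≡⟨ map-cong (λ b → sym (not-distribʳ-xor (isOdd x) b)) x ⟩
    map (not ∘ (isOdd x xor_)) x           ≡⟨ map-∘ _ _ x ⟩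
    negate (twist x)                       ∎

-- Vanishing mixed second differences, written without subtraction: the change caused by one flip
-- does not depend on the other coordinates.
Affine : (Vec Bool n → ℕ) → Set
Affine {n} F = ∀ {i j : Fin n} → i ≢ j → ∀ x → F x + F (flip i (flip j x)) ≡ F (flip i x) + F (flip j x)

module _ (n-even : isOdd (replicate n true) ≡ false) where
  open Twist {n} n-even

  -- Toggling a bit of y moves twist y to the antipode of a neighbour, and E
  -- takes complementary values at antipodes: a face sum of E becomes a second
  -- difference of E ∘ twist.
  perfect⇒affine : ∀ {E : Vec Bool n → ℕ} → Perfect E → Affine (E ∘ twist)
  perfect⇒affine {E} E-perfect {i} {j} i≢j y = ℕ.+-cancelʳ-≡ (E (flip i x) + E (flip j x)) _ _ (begin
    (E x + E (twist (flip i (flip j y)))) + (E (flip i x) + E (flip j x))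
      ≡⟨ cong (λ z → (E x + E z) + (E (flip i x) + E (flip j x))) (twist-flip-flip i j y) ⟩
    (E x + E (flip i (flip j x))) + (E (flip i x) + E (flip j x))
      ≡⟨ regroup (E x) _ _ _ ⟩
    E x + E (flip i x) + E (flip j x) + E (flip i (flip j x))
      ≡⟨ face i≢j x ⟩
    2 * c
      ≡⟨ cong (c +_) (ℕ.+-identityʳ c) ⟩
    c + c
      ≡⟨ cong₂ _+_ (antipodal (flip i x)) (antipodal (flip j x)) ⟨
    (E (flip i x) + E (negate (flip i x))) + (E (flip j x) + E (negate (flip j x)))
      ≡⟨ regroup′ (E (flip i x)) _ _ _ ⟩
    (E (negate (flip i x)) + E (negate (flip j x))) + (E (flip i x) + E (flip j x))
      ≡⟨ cong₂ (λ u v → (E u + E v) + (E (flip i x) + E (flip j x))) (twist-flip i y) (twist-flip j y) ⟨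
    (E (twist (flip i y)) + E (twist (flip j y))) + (E (flip i x) + E (flip j x)) ∎)
    where
    open Perfect E-perfect renaming (antipodal-sum to c)
    x = twist y
    regroup : ∀ a b c d → (a + b) + (c + d) ≡ a + c + d + b
    regroup = solve-∀
    regroup′ : ∀ a b c d → (a + b) + (c + d) ≡ (b + d) + (a + c)
    regroup′ = solve-∀

  -- After twisting, a face consists of the diagonal `y`, `flip i (flip j y)` and the antipodes of
  -- the other two corners. Affinity trades the diagonal for those corners, which leaves two
  -- antipodal pairs.
  affine⇒perfect : ∀ {F : Vec Bool n → ℕ} → Affine F →
                   ∀ {c} → (∀ y → F y + F (negate y) ≡ c) → Perfect (F ∘ twist)
  affine⇒perfect {F} affine {c} antipodal = record
    { antipodal-sum = c
    ; antipodal     = λ x → trans (cong (λ z → F (twist x) + F z) (twist-negate x)) (antipodal (twist x))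
    ; face          = λ {i} {j} → face {i} {j}
    }
    where
    face : ∀ {i j} → i ≢ j → ∀ x → F (twist x) + F (twist (flip i x)) + F (twist (flip j x))
      + F (twist (flip i (flip j x))) ≡ 2 * c
    face {i} {j} i≢j x = begin
      F y + F (twist (flip i x)) + F (twist (flip j x)) + F (twist (flip i (flip j x)))
        ≡⟨ cong₂ _+_ (cong₂ (λ u v → F y + F u + F v) (twist-flip i x) (twist-flip j x))
             (cong F (twist-flip-flip i j x)) ⟩
      F y + F (negate (flip i y)) + F (negate (flip j y)) + F (flip i (flip j y))
        ≡⟨ regroup (F y) _ _ _ ⟩
      (F y + F (flip i (flip j y))) + (F (negate (flip i y)) + F (negate (flip j y)))
        ≡⟨ cong (_+ (F (negate (flip i y)) + F (negate (flip j y)))) (affine i≢j y) ⟩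
      (F (flip i y) + F (flip j y)) + (F (negate (flip i y)) + F (negate (flip j y)))
        ≡⟨ regroup′ (F (flip i y)) _ _ _ ⟩
      (F (flip i y) + F (negate (flip i y))) + (F (flip j y) + F (negate (flip j y)))
        ≡⟨ cong₂ _+_ (antipodal (flip i y)) (antipodal (flip j y)) ⟩
      c + c
        ≡⟨ cong (c +_) (ℕ.+-identityʳ c) ⟨
      2 * c ∎
      where
      y = twist x
      regroup : ∀ a b c d → a + b + c + d ≡ (a + d) + (b + c)
      regroup = solve-∀
      regroup′ : ∀ a b c d → (a + b) + (c + d) ≡ (a + c) + (b + d)
      regroup′ = solve-∀

-- Affine functions as subset sums

weigh : (Fin n → ℕ) → Vec Bool n → ℕ
weigh w x = sum λ k → if lookup x k then w k else 0

weigh-cong : ∀ {v w : Fin n → ℕ} → v ≗ w → weigh v ≗ weigh w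
weigh-cong p x = sum-cong-≗ λ k → cong (if lookup x k then_else 0) (p k)

weigh-double : ∀ (w : Fin n → ℕ) x → weigh (λ k → 2 * w k) x ≡ 2 * weigh w x
weigh-double w []      = refl
weigh-double w (b ∷ x) = trans (cong₂ _+_ (if-* b) (weigh-double (w ∘ suc) x))
  (sym (ℕ.*-distribˡ-+ 2 (if b then w zero else 0) (weigh (w ∘ suc) x)))
  where
  if-* : ∀ b → (if b then 2 * w zero else 0) ≡ 2 * (if b then w zero else 0)
  if-* false = refl
  if-* true  = refl

weigh-insertAt : ∀ (w : Fin (suc n) → ℕ) x k b →
                 weigh w (insertAt x k b) ≡ (if b then w k else 0) + weigh (w ∘ punchIn k) x
weigh-insertAt w x k b = trans
  (sum-remove {i = k} λ j → if lookup (insertAt x k b) j then w j else 0) (cong₂ _+_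
  (cong (if_then w k else 0) (insertAt-lookup x k b))
  (sum-cong-≗ λ j → cong (if_then w (punchIn k j) else 0) (insertAt-punchIn x k b j)))

weigh-affine : ∀ (w : Fin n → ℕ) → Affine (weigh w)
weigh-affine w {zero}  {zero}  i≢j x       = ⊥-elim (i≢j refl)
weigh-affine w {zero}  {suc j} i≢j (b ∷ x) = regroup (if b then w zero else 0) _ (if not b then w zero else 0) _
  where
  regroup : ∀ a b c d → (a + b) + (c + d) ≡ (c + b) + (a + d)
  regroup = solve-∀
weigh-affine w {suc i} {zero}  i≢j (b ∷ x) = regroup (if b then w zero else 0) _ (if not b then w zero else 0) _
  where
  regroup : ∀ a b c d → (a + b) + (c + d) ≡ (a + d) + (c + b)
  regroup = solve-∀
weigh-affine w {suc i} {suc j} i≢j (b ∷ x) = begin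
  (β + weigh w′ x) + (β + weigh w′ (flip i (flip j x))) ≡⟨ regroup β _ β _ ⟩
  (β + β) + (weigh w′ x + weigh w′ (flip i (flip j x))) ≡⟨ cong ((β + β) +_) (weigh-affine w′ (i≢j ∘ cong suc) x) ⟩
  (β + β) + (weigh w′ (flip i x) + weigh w′ (flip j x)) ≡⟨ regroup β β (weigh w′ (flip i x)) _ ⟩
  (β + weigh w′ (flip i x)) + (β + weigh w′ (flip j x)) ∎
  where
  w′ = w ∘ suc
  β = if b then w zero else 0
  regroup : ∀ a b c d → (a + b) + (c + d) ≡ (a + c) + (b + d)
  regroup = solve-∀

weigh-negate : ∀ (w : Fin n → ℕ) x → weigh w x + weigh w (negate x) ≡ sum w
weigh-negate w []      = refl
weigh-negate w (b ∷ x) = trans (regroup (if b then w zero else 0) _ _ _)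
  (cong₂ _+_ (complement b) (weigh-negate (w ∘ suc) x))
  where
  regroup : ∀ a b c d → (a + b) + (c + d) ≡ (a + c) + (b + d)
  regroup = solve-∀
  complement : ∀ b → (if b then w zero else 0) + (if not b then w zero else 0) ≡ w zero
  complement false = refl
  complement true  = ℕ.+-identityʳ _

affine-∷ : ∀ (F : Vec Bool (suc n) → ℕ) b → Affine F → Affine (F ∘ (b ∷_))
affine-∷ F b affine {i} {j} i≢j x = affine {suc i} {suc j} (λ { refl → i≢j refl }) (b ∷ x)

-- Raising the leading bit adds the same amount at every `x`, as walking from `zeros` along edges
-- shows. That amount is the first weight, and the restriction to leading bit `false` is again
-- affine and zero at `zeros`.
affine⇒weigh : ∀ (F : Vec Bool n → ℕ) → Affine F → F zeros ≡ 0 →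
               ∀ x → F x ≡ weigh (λ k → F (flip k zeros)) x
affine⇒weigh F affine F0 []          = F0
affine⇒weigh F affine F0 (false ∷ x) =
  affine⇒weigh (F ∘ (false ∷_)) (affine-∷ F false affine) F0 x
affine⇒weigh F affine F0 (true ∷ x)  = trans
  (flip-induction (λ x → F (true ∷ x) ≡ F (true ∷ zeros) + F (false ∷ x))
    (trans (sym (ℕ.+-identityʳ _)) (cong (F (true ∷ zeros) +_) (sym F0))) step x)
  (cong (F (true ∷ zeros) +_)
    (affine⇒weigh (F ∘ (false ∷_)) (affine-∷ F false affine) F0 x))
  where
  step : ∀ i {x} → F (true ∷ x) ≡ F (true ∷ zeros) + F (false ∷ x) →
         F (true ∷ flip i x) ≡ F (true ∷ zeros) + F (false ∷ flip i x)
  step i {x} p = ℕ.+-cancelˡ-≡ (F (false ∷ x)) _ _ (begin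
    F (false ∷ x) + F (true ∷ flip i x)                          ≡⟨ affine {zero} {suc i} (λ ()) (false ∷ x) ⟩
    F (true ∷ x) + F (false ∷ flip i x)                          ≡⟨ cong (_+ F (false ∷ flip i x)) p ⟩
    (F (true ∷ zeros) + F (false ∷ x)) + F (false ∷ flip i x)    ≡⟨ regroup (F (true ∷ zeros)) _ _ ⟩
    F (false ∷ x) + (F (true ∷ zeros) + F (false ∷ flip i x))    ∎)
    where
    regroup : ∀ a b c → (a + b) + c ≡ b + (a + c)
    regroup = solve-∀

-- Subset sums that enumerate an initial segment

even-or-odd : ∀ v → (∃[ h ] v ≡ 2 * h) ⊎ (∃[ h ] v ≡ suc (2 * h))
even-or-odd zero    = inj₁ (0 , refl)
even-or-odd (suc v) with even-or-odd v
... | inj₁ (h , refl) = inj₂ (h , refl)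
... | inj₂ (h , refl) = inj₁ (suc h , sym (ℕ.*-suc 2 h))

-- A bijection onto the numbers below `N`, kept in ℕ rather than `Fin N` so that its values can be
-- added and halved.
record EnumeratesBelow (N : ℕ) (f : Vec Bool n → ℕ) : Set where
  field
    injective  : ∀ x y → f x ≡ f y → x ≡ y
    bounded    : ∀ x → f x < N
    surjective : ∀ {v} → v < N → ∃[ x ] f x ≡ v

binary : Vec Bool n → ℕ
binary = weigh λ k → 2 ^ toℕ k

binary-∷ : ∀ b (x : Vec Bool n) → binary (b ∷ x) ≡ (if b then 1 else 0) + 2 * binary x
binary-∷ b x = cong ((if b then 1 else 0) +_) (weigh-double _ x)

binary-enumerates : ∀ n → EnumeratesBelow (2 ^ n) (binary {n})
binary-enumerates zero = record
  { injective  = λ { [] [] _ → refl }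
  ; bounded    = λ { [] → s≤s z≤n }
  ; surjective = λ { (s≤s z≤n) → [] , refl }
  }
binary-enumerates (suc n) = record
  { injective  = λ { (b ∷ x) (b′ ∷ y) p → inj b b′ (trans (sym (binary-∷ b x)) (trans p (binary-∷ b′ y))) }
  ; bounded    = λ { (b ∷ x) → subst (_< 2 ^ suc n) (sym (binary-∷ b x)) (bound b x) }
  ; surjective = surj
  }
  where
  open EnumeratesBelow (binary-enumerates n)
  inj : ∀ b b′ {x y} →
        (if b then 1 else 0) + 2 * binary x ≡ (if b′ then 1 else 0) + 2 * binary y → b ∷ x ≡ b′ ∷ y
  inj false false p = cong (false ∷_) (injective _ _ (ℕ.*-cancelˡ-≡ _ _ 2 p))
  inj true  true  p = cong (true ∷_) (injective _ _ (ℕ.*-cancelˡ-≡ _ _ 2 (ℕ.suc-injective p)))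
  inj false true  {x} {y} p = ⊥-elim (ℕ.even≢odd (binary x) (binary y) p)
  inj true  false {x} {y} p = ⊥-elim (ℕ.even≢odd (binary y) (binary x) (sym p))
  bound : ∀ b (x : Vec Bool n) → (if b then 1 else 0) + 2 * binary x < 2 ^ suc n
  bound b x = ℕ.≤-trans (ℕ.≤-trans (s≤s (ℕ.+-monoˡ-≤ (2 * binary x) (bit≤1 b)))
    (ℕ.≤-reflexive (sym (ℕ.*-suc 2 (binary x))))) (ℕ.*-monoʳ-≤ 2 (bounded x))
    where
    bit≤1 : ∀ b → (if b then 1 else 0) ≤ 1
    bit≤1 false = z≤n
    bit≤1 true  = s≤s z≤n
  surj : ∀ {v} → v < 2 ^ suc n → ∃[ x ] binary x ≡ v
  surj {v} v< with even-or-odd v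
  ... | inj₁ (h , refl) = let x , p = surjective {h} (ℕ.*-cancelˡ-< 2 _ _ v<) in
    false ∷ x , trans (binary-∷ false x) (cong (2 *_) p)
  ... | inj₂ (h , refl) = let x , p = surjective {h} (ℕ.*-cancelˡ-< 2 _ _ (ℕ.<-trans (ℕ.n<1+n _) v<)) in
    true ∷ x , trans (binary-∷ true x) (cong (λ s → suc (2 * s)) p)

weigh-flip-zeros : ∀ (w : Fin n → ℕ) k → weigh w (flip k zeros) ≡ w k
weigh-flip-zeros {suc n} w zero    = trans (cong (w zero +_) (weigh-zeros (w ∘ suc))) (ℕ.+-identityʳ _)
  where
  weigh-zeros : ∀ {n} (w : Fin n → ℕ) → weigh w zeros ≡ 0
  weigh-zeros {zero}  w = refl
  weigh-zeros {suc n} w = weigh-zeros (w ∘ suc)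
weigh-flip-zeros {suc n} w (suc k) = weigh-flip-zeros (w ∘ suc) k

-- Natural numbers with sum 1 are all zero except for a single 1.
weight-one : ∀ (w : Fin n → ℕ) x → weigh w x ≡ 1 → ∃[ k ] w k ≡ 1
weight-one w (false ∷ x) p = let k , q = weight-one (w ∘ suc) x p in suc k , q
weight-one w (true ∷ x)  p with w zero in eq
... | 0 = let k , q = weight-one (w ∘ suc) x p in suc k , q
... | 1 = zero , eq
... | suc (suc _) with () ← p

-- Some weight is 1.  The sums of the other weights are even: if 2i + 1 were the
-- least odd one, the subset with sum 2i either avoids the weight 1, so 2i + 1 has
-- two representations, or contains it, and 2i - 1 is a smaller odd sum.  Halve
-- the other weights and repeat.
weights-powers : ∀ (w : Fin n → ℕ) → EnumeratesBelow (2 ^ n) (weigh w) →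
                 Σ[ π ∈ Permutation n n ] ∀ k → w k ≡ 2 ^ toℕ (π ⟨$⟩ʳ k)
weights-powers {zero}  w enum = Permutation.id , λ ()
-- The weight 1 takes exponent 0. Halving lowers the exponents of the other weights by one, and
-- `insert` raises them again.
weights-powers {suc n} w enum = insert k₀ zero π , w-power
  where
  open EnumeratesBelow enum
  1<2^1+n : 1 < 2 ^ suc n
  1<2^1+n = ℕ.*-monoʳ-≤ 2 (ℕ.m^n>0 2 n)
  k₀ : Fin (suc n)
  k₀ = proj₁ (weight-one w (proj₁ (surjective 1<2^1+n)) (proj₂ (surjective 1<2^1+n)))
  w-k₀ : w k₀ ≡ 1
  w-k₀ = proj₂ (weight-one w (proj₁ (surjective 1<2^1+n)) (proj₂ (surjective 1<2^1+n)))
  w′ : Fin n → ℕ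
  w′ = w ∘ punchIn k₀

  weigh-with : ∀ x → weigh w (insertAt x k₀ true) ≡ suc (weigh w′ x)
  weigh-with x = trans (weigh-insertAt w x k₀ true) (cong (_+ weigh w′ x) w-k₀)
  weigh-without : ∀ x → weigh w (insertAt x k₀ false) ≡ weigh w′ x
  weigh-without x = weigh-insertAt w x k₀ false

  sum-of : ∀ {v} → v < 2 ^ suc n → (∃[ x ] suc (weigh w′ x) ≡ v) ⊎ (∃[ x ] weigh w′ x ≡ v)
  sum-of v< with surjective v<
  ... | x , p with lookup x k₀ in eq
  ...   | true  = inj₁ (removeAt x k₀ , trans (sym (weigh-with _)) (trans (cong (weigh w) restore) p))
    where
    restore : insertAt (removeAt x k₀) k₀ true ≡ x
    restore = trans (cong (insertAt _ k₀) (sym eq)) (insertAt-removeAt x k₀)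
  ...   | false = inj₂ (removeAt x k₀ , trans (sym (weigh-without _)) (trans (cong (weigh w) restore) p))
    where
    restore : insertAt (removeAt x k₀) k₀ false ≡ x
    restore = trans (cong (insertAt _ k₀) (sym eq)) (insertAt-removeAt x k₀)

  not-odd : ∀ i x → weigh w′ x ≢ suc (2 * i)
  not-odd i x p with sum-of
    (ℕ.<-trans (ℕ.≤-reflexive (sym (trans (weigh-without x) p))) (bounded (insertAt x k₀ false)))
  -- The descent ends at `i = 0`, where this case cannot occur: a subset containing the weight 1
  -- does not have sum 0.
  not-odd (suc i) x p | inj₁ (y , q) = not-odd i y (trans (ℕ.suc-injective q) (ℕ.+-suc i (i + 0)))
  not-odd i x p | inj₂ (y , q) with () ← trans (sym (insertAt-lookup y k₀ true))
    (trans (cong (λ z → lookup z k₀) (injective (insertAt y k₀ true) (insertAt x k₀ false)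
             (trans (weigh-with y) (trans (cong suc q) (sym (trans (weigh-without x) p))))))
           (insertAt-lookup x k₀ false))

  half : ∀ l → ∃[ u ] w′ l ≡ 2 * u
  half l with even-or-odd (w′ l)
  ... | inj₁ r       = r
  ... | inj₂ (h , p) = ⊥-elim (not-odd h (flip l zeros) (trans (weigh-flip-zeros w′ l) p))

  u : Fin n → ℕ
  u l = proj₁ (half l)

  weigh-w′ : ∀ x → weigh w′ x ≡ 2 * weigh u x
  weigh-w′ x = trans (weigh-cong (λ l → proj₂ (half l)) x) (weigh-double u x)

  u-enumerates : EnumeratesBelow (2 ^ n) (weigh u)
  u-enumerates = record
    { injective  = λ x y p → trans (sym (removeAt-insertAt x k₀ false)) (trans
        (cong (λ z → removeAt z k₀) (injective (insertAt x k₀ false) (insertAt y k₀ false)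
          (trans (weigh-without x) (trans (weigh-w′ x) (trans (cong (2 *_) p)
            (sym (trans (weigh-without y) (weigh-w′ y))))))))
        (removeAt-insertAt y k₀ false))
    ; bounded    = λ x → ℕ.*-cancelˡ-< 2 _ _ (subst (_< 2 ^ suc n)
        (trans (weigh-without x) (weigh-w′ x)) (bounded (insertAt x k₀ false)))
    ; surjective = surj
    }
    where
    surj : ∀ {v} → v < 2 ^ n → ∃[ x ] weigh u x ≡ v
    surj {v} v< with sum-of (ℕ.*-monoʳ-< 2 v<)
    -- All other weights are even, so a subset containing the weight 1 has odd sum and cannot
    -- represent 2v.
    ... | inj₁ (x , p) = ⊥-elim (ℕ.even≢odd v (weigh u x) (trans (sym p) (cong suc (weigh-w′ x))))
    ... | inj₂ (x , p) = x , ℕ.*-cancelˡ-≡ _ _ 2 (trans (sym (weigh-w′ x)) p)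

  π : Permutation n n
  π = proj₁ (weights-powers u u-enumerates)

  w-power : ∀ k → w k ≡ 2 ^ toℕ (insert k₀ zero π ⟨$⟩ʳ k)
  w-power k with k₀ ≟ k
  ... | yes refl = w-k₀
  ... | no k₀≢k  = begin
    w k                     ≡⟨ cong w (punchIn-punchOut k₀≢k) ⟨
    w′ l                    ≡⟨ proj₂ (half l) ⟩
    2 * u l                 ≡⟨ cong (2 *_) (proj₂ (weights-powers u u-enumerates) l) ⟩
    2 ^ suc (toℕ (π ⟨$⟩ʳ l)) ∎
    where l = punchOut k₀≢k

-- Normal form and the action

signed-negate : ∀ (g : Signed n) x → signed g (negate x) ≡ negate (signed g x)
signed-negate (a , σ) x = lookup-ext λ i → begin
  lookup (signed (a , σ) (negate x)) i                      ≡⟨ lookup∘tabulate _ i ⟩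
  bit (a i) xor lookup (negate x) (Inverse.from σ i)        ≡⟨ cong (bit (a i) xor_)
                                                                 (lookup-map (Inverse.from σ i) not x) ⟩
  bit (a i) xor not (lookup x (Inverse.from σ i))           ≡⟨ not-distribʳ-xor (bit (a i)) _ ⟨
  not (bit (a i) xor lookup x (Inverse.from σ i))           ≡⟨ cong not (lookup∘tabulate _ i) ⟨
  not (lookup (signed (a , σ) x) i)                         ≡⟨ lookup-map i not (signed (a , σ) x) ⟨
  lookup (negate (signed (a , σ) x)) i                      ∎

signed⁻¹-negate : ∀ (g : Signed n) y → signed⁻¹ g (negate y) ≡ negate (signed⁻¹ g y)
signed⁻¹-negate g y = begin
  signed⁻¹ g (negate y)                       ≡⟨ cong (signed⁻¹ g ∘ negate) (signed-signed⁻¹ g y) ⟨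
  signed⁻¹ g (negate (signed g (signed⁻¹ g y))) ≡⟨ cong (signed⁻¹ g) (signed-negate g (signed⁻¹ g y)) ⟨
  signed⁻¹ g (signed g (negate (signed⁻¹ g y))) ≡⟨ signed⁻¹-signed g (negate (signed⁻¹ g y)) ⟩
  negate (signed⁻¹ g y)                       ∎

signed⁻¹-cong : ∀ {g h : Signed n} → g B.≈ h → signed⁻¹ g ≗ signed⁻¹ h
signed⁻¹-cong {g = g} {h} p y = begin
  signed⁻¹ g y                          ≡⟨ cong (signed⁻¹ g) (signed-signed⁻¹ h y) ⟨
  signed⁻¹ g (signed h (signed⁻¹ h y))  ≡⟨ cong (signed⁻¹ g) (signed-cong {g = g} {h} p (signed⁻¹ h y)) ⟨
  signed⁻¹ g (signed g (signed⁻¹ h y))  ≡⟨ signed⁻¹-signed g (signed⁻¹ h y) ⟩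
  signed⁻¹ h y                          ∎

signed⁻¹-homo : ∀ (g h : Signed n) → signed⁻¹ (g B.∙ h) ≗ signed⁻¹ h ∘ signed⁻¹ g
signed⁻¹-homo g h y = begin
  signed⁻¹ (g B.∙ h) y                        ≡⟨ cong (signed⁻¹ (g B.∙ h)) (signed-signed⁻¹ g y) ⟨
  signed⁻¹ (g B.∙ h) (signed g (signed⁻¹ g y)) ≡⟨ cong (signed⁻¹ (g B.∙ h) ∘ signed g)
                                                    (signed-signed⁻¹ h (signed⁻¹ g y)) ⟨
  signed⁻¹ (g B.∙ h) (signed g (signed h z))  ≡⟨ cong (signed⁻¹ (g B.∙ h)) (signed-homo g h z) ⟨
  signed⁻¹ (g B.∙ h) (signed (g B.∙ h) z)     ≡⟨ signed⁻¹-signed (g B.∙ h) z ⟩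
  z                                           ∎
  where z = signed⁻¹ h (signed⁻¹ g y)

signed-ε : ∀ (x : Vec Bool n) → signed B.ε x ≡ x
signed-ε x = tabulate∘lookup x

perfect-cong : ∀ {E F : Vec Bool n → ℕ} → E ≗ F → Perfect E → Perfect F
perfect-cong p E-perfect = record
  { antipodal-sum = antipodal-sum
  ; antipodal     = λ x → trans (sym (cong₂ _+_ (p x) (p (negate x)))) (antipodal x)
  ; face          = λ k≢l x → trans
      (sym (cong₂ _+_ (cong₂ _+_ (cong₂ _+_ (p x) (p _)) (p _)) (p _))) (face k≢l x)
  }
  where open Perfect E-perfect

perfect-signed⁻¹ : ∀ {E : Vec Bool n → ℕ} (g : Signed n) → Perfect E → Perfect (E ∘ signed⁻¹ g)
perfect-signed⁻¹ {E = E} g@(a , σ) E-perfect = record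
  { antipodal-sum = antipodal-sum
  ; antipodal     = λ y → trans
      (cong (λ z → E (signed⁻¹ g y) + E z) (signed⁻¹-negate g y)) (antipodal (signed⁻¹ g y))
  ; face          = λ {k} {l} k≢l y → trans
      (cong₂ _+_ (cong₂ (λ u v → E (signed⁻¹ g y) + E u + E v) (signed⁻¹-flip g k y) (signed⁻¹-flip g l y))
        (cong E (trans (signed⁻¹-flip g k (flip l y)) (cong (flip (from k)) (signed⁻¹-flip g l y)))))
      (face (λ p → k≢l (trans (sym (strictlyInverseˡ k)) (trans (cong to p) (strictlyInverseˡ l))))
        (signed⁻¹ g y))
  }
  where
  open Perfect E-perfect
  open Inverse σ

2^2m≡4^m : ∀ m → 2 ^ (2 * m) ≡ 4 ^ m
2^2m≡4^m m = sym (ℕ.^-*-assoc 2 2 m)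

open MostPerfectHypercube

-- Entries lowered by one, so that the least value is 0, the value of the empty subset sum.
rank : MostPerfectHypercube m → Vec Bool (2 * m) → ℕ
rank {m} H x = toℕ (index H (position {m} x))

rank-perfect : ∀ (H : MostPerfectHypercube m) → Perfect (suc ∘ rank H)
rank-perfect H = mostPerfect⇒perfect (isMostPerfect H)

rank-enumerates : ∀ (H : MostPerfectHypercube m) → EnumeratesBelow (2 ^ (2 * m)) (rank H)
rank-enumerates {m} H = record
  { injective  = λ x y p → position-injective {m} x y (proj₁ (bijective H) (toℕ-injective p))
  ; bounded    = λ x → subst (rank H x <_) (sym (2^2m≡4^m m)) (toℕ<n _)
  ; surjective = λ {v} v< → let v<4^m = subst (v <_) (2^2m≡4^m m) v<
                                p , q = proj₂ (bijective H) (fromℕ< v<4^m) in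
      bits p , trans (cong toℕ (q (position-bits p))) (toℕ-fromℕ< v<4^m)
  }

enumerates-cong : ∀ {N} {f g : Vec Bool n → ℕ} → f ≗ g → EnumeratesBelow N f → EnumeratesBelow N g
enumerates-cong p enum = record
  { injective  = λ x y q → injective x y (trans (p x) (trans q (sym (p y))))
  ; bounded    = λ x → subst (_< _) (p x) (bounded x)
  ; surjective = λ v< → let x , q = surjective v< in x , trans (sym (p x)) q
  }
  where open EnumeratesBelow enum

enumerates-∘ : ∀ {N} {f : Vec Bool n → ℕ} (β : Vec Bool n ↔ Vec Bool n) →
               EnumeratesBelow N f → EnumeratesBelow N (f ∘ Inverse.to β)
enumerates-∘ {f = f} β enum = record
  { injective  = λ x y q → trans (sym (strictlyInverseʳ x))
      (trans (cong from (injective _ _ q)) (strictlyInverseʳ y))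
  ; bounded    = λ x → bounded (to x)
  ; surjective = λ v< → let x , q = surjective v< in from x , trans (cong f (strictlyInverseˡ x)) q
  }
  where
  open EnumeratesBelow enum
  open Inverse β

permute : Permutation n n → Signed n
permute π = (λ _ → 0ℙ) , π

binary-permute : ∀ (π : Permutation n n) x →
                 binary (signed (permute π) x) ≡ weigh (λ k → 2 ^ toℕ (π ⟨$⟩ʳ k)) x
binary-permute π x = trans (sum-permute _ π) (sum-cong-≗ λ k →
  cong (if_then 2 ^ toℕ (π ⟨$⟩ʳ k) else 0)
    (trans (lookup∘tabulate _ (π ⟨$⟩ʳ k)) (cong (lookup x) (Inverse.strictlyInverseʳ π k))))

module _ (m : ℕ) where
  open Twist {2 * m} (isOdd-ones m)

  twist↔ : Vec Bool (2 * m) ↔ Vec Bool (2 * m)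
  twist↔ = mk↔ₛ′ twist twist twist-involutive twist-involutive

  -- After twisting, a translation takes `zeros` to the twist of the vertex of least rank, and a
  -- permutation sorts the weights into powers of two. Undoing the translation, permuting and
  -- conjugating by `twist` gives the map `s`, which `signed-unique` recognises as a signed
  -- permutation.
  rank-normalForm : ∀ (H : MostPerfectHypercube m) → ∃[ g ] ∀ x → rank H x ≡ binary (twist (signed g x))
  rank-normalForm H = g , λ x → begin
      rank H x
        ≡⟨ cong (rank H) (trans (cong twist (signed-signed⁻¹ t (twist x))) (twist-involutive x)) ⟨
      G (signed⁻¹ t (twist x))
        ≡⟨ G-weigh (signed⁻¹ t (twist x)) ⟩
      weigh w (signed⁻¹ t (twist x))
        ≡⟨ weigh-cong w-powers (signed⁻¹ t (twist x)) ⟩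
      weigh (λ k → 2 ^ toℕ (π ⟨$⟩ʳ k)) (signed⁻¹ t (twist x))
        ≡⟨ binary-permute π (signed⁻¹ t (twist x)) ⟨
      binary (signed (permute π) (signed⁻¹ t (twist x)))
        ≡⟨ cong binary (twist-involutive (signed (permute π) (signed⁻¹ t (twist x)))) ⟨
      binary (twist (s x))
        ≡⟨ cong (binary ∘ twist) (signed-unique π s s-flip x) ⟨
      binary (twist (signed g x)) ∎
    where
    minimum : ∃[ x ] rank H x ≡ 0
    minimum = EnumeratesBelow.surjective (rank-enumerates H) (ℕ.m^n>0 2 (2 * m))

    x₀ y₀ : Vec Bool (2 * m)
    x₀ = proj₁ minimum
    y₀ = twist x₀

    t : Signed (2 * m)
    t = translation (parity ∘ lookup y₀)

    G : Vec Bool (2 * m) → ℕ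
    G = rank H ∘ twist ∘ signed t

    -- Affinity is available for entries, that is for successors of ranks. Both sides add two
    -- values, so the units cancel.
    G-affine : Affine G
    G-affine {i} {j} i≢j x = ℕ.suc-injective (ℕ.suc-injective (begin
      suc (suc (G x + G (flip i (flip j x))))
        ≡⟨ cong suc (ℕ.+-suc (G x) _) ⟨
      suc (G x) + suc (G (flip i (flip j x)))
        ≡⟨ cong (λ z → suc (G x) + suc (rank H (twist z)))
             (trans (signed-flip t i (flip j x)) (cong (flip i) (signed-flip t j x))) ⟩
      suc (G x) + suc (rank H (twist (flip i (flip j (signed t x)))))
        ≡⟨ perfect⇒affine {2 * m} (isOdd-ones m) (rank-perfect H) i≢j (signed t x) ⟩
      suc (rank H (twist (flip i (signed t x)))) + suc (rank H (twist (flip j (signed t x))))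
        ≡⟨ cong₂ (λ u v → suc (rank H (twist u)) + suc (rank H (twist v)))
             (signed-flip t i x) (signed-flip t j x) ⟨
      suc (G (flip i x)) + suc (G (flip j x))
        ≡⟨ cong suc (ℕ.+-suc (G (flip i x)) _) ⟩
      suc (suc (G (flip i x) + G (flip j x))) ∎))

    G-zeros : G zeros ≡ 0
    G-zeros = begin
      rank H (twist (signed t zeros)) ≡⟨ cong (rank H ∘ twist) (lookup-ext {x = signed t zeros} {y₀} λ i →
                                           trans (lookup-signed-zeros t i) (bit-parity (lookup y₀ i))) ⟩
      rank H (twist (twist x₀))       ≡⟨ cong (rank H) (twist-involutive x₀) ⟩
      rank H x₀                       ≡⟨ proj₂ minimum ⟩
      0                               ∎

    w : Fin (2 * m) → ℕ
    w k = G (flip k zeros)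

    G-weigh : G ≗ weigh w
    G-weigh = affine⇒weigh G G-affine G-zeros

    powers = weights-powers w (enumerates-cong G-weigh
      (enumerates-∘ (Automorphism.perm (signedAutomorphism t)) (enumerates-∘ twist↔ (rank-enumerates H))))
    π : Permutation (2 * m) (2 * m)
    π = proj₁ powers
    w-powers = proj₂ powers

    s : Vec Bool (2 * m) → Vec Bool (2 * m)
    s x = twist (signed (permute π) (signed⁻¹ t (twist x)))

    g : Signed (2 * m)
    g = parity ∘ lookup (s zeros) , π

    -- Each of the two twists contributes an antipodal map. The inner one passes through the signed
    -- permutations and the outer twist, and meets the other.
    s-flip : ∀ i x → s (flip i x) ≡ flip (π ⟨$⟩ʳ i) (s x)
    s-flip i x = begin
      twist (signed (permute π) (signed⁻¹ t (twist (flip i x))))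
        ≡⟨ cong (twist ∘ signed (permute π) ∘ signed⁻¹ t) (twist-flip i x) ⟩
      twist (signed (permute π) (signed⁻¹ t (negate (flip i (twist x)))))
        ≡⟨ cong (twist ∘ signed (permute π)) (trans (signed⁻¹-negate t (flip i (twist x)))
             (cong negate (signed⁻¹-flip t i (twist x)))) ⟩
      twist (signed (permute π) (negate (flip i u)))
        ≡⟨ cong twist (trans (signed-negate (permute π) (flip i u))
             (cong negate (signed-flip (permute π) i u))) ⟩
      twist (negate (flip (π ⟨$⟩ʳ i) (signed (permute π) u)))
        ≡⟨ twist-negate (flip (π ⟨$⟩ʳ i) (signed (permute π) u)) ⟩
      negate (twist (flip (π ⟨$⟩ʳ i) (signed (permute π) u)))
        ≡⟨ cong negate (twist-flip (π ⟨$⟩ʳ i) (signed (permute π) u)) ⟩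
      negate (negate (flip (π ⟨$⟩ʳ i) (s x)))
        ≡⟨ negate-involutive (flip (π ⟨$⟩ʳ i) (s x)) ⟩
      flip (π ⟨$⟩ʳ i) (s x) ∎
      where u = signed⁻¹ t (twist x)

  -- The normal form taken as a definition: as a subset sum, `binary` is affine with constant
  -- antipodal sums, and twisting it gives a perfect function.
  binaryHypercube : MostPerfectHypercube m
  binaryHypercube = record
    { index         = index₀
    ; bijective     = (λ {p} {q} e → trans (sym (position-bits p)) (trans
        (cong (position {m}) (injective (bits p) (bits q)
          (trans (sym (toℕ-index p)) (trans (cong toℕ e) (toℕ-index q)))))
        (position-bits q)))
      , λ y → let x , e = surjective (subst (toℕ y <_) (sym (2^2m≡4^m m)) (toℕ<n y)) in
          position x , λ { refl → toℕ-injective (trans (toℕ-index (position x))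
            (trans (cong (binary ∘ twist) (bits-position {m} x)) e)) }
    ; isMostPerfect = perfect⇒mostPerfect (perfect-cong
        (λ x → cong suc (sym (trans (toℕ-index (position x)) (cong (binary ∘ twist) (bits-position {m} x)))))
        (affine⇒perfect {2 * m} (isOdd-ones m) {suc ∘ binary} suc-affine suc-antipodal))
    }
    where
    open EnumeratesBelow (enumerates-∘ twist↔ (binary-enumerates (2 * m)))
    index₀ : Position m → Fin (4 ^ m)
    index₀ p = fromℕ< (subst (binary (twist (bits p)) <_) (2^2m≡4^m m) (bounded (bits p)))
    toℕ-index : ∀ p → toℕ (index₀ p) ≡ binary (twist (bits p))
    toℕ-index p = toℕ-fromℕ< _
    suc-affine : Affine (suc ∘ binary {2 * m})
    suc-affine {i} {j} i≢j x = cong suc (trans (ℕ.+-suc (binary x) _)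
      (trans (cong suc (weigh-affine (λ k → 2 ^ toℕ k) i≢j x)) (sym (ℕ.+-suc (binary (flip i x)) _))))
    -- Complementary subsets use every weight once, and counting from 1 adds a unit at each end: the
    -- antipodal sum is 4ᵐ + 1.
    suc-antipodal : ∀ x → suc (binary {2 * m} x) + suc (binary (negate x))
                          ≡ suc (suc (sum {2 * m} λ k → 2 ^ toℕ k))
    suc-antipodal x = cong suc (trans (ℕ.+-suc (binary x) _) (cong suc (weigh-negate _ x)))

  -- The Weyl group acting on most-perfect hypercubes

  private
    n′ = 2 * m
    ρ : Signed n′ → Automorphism (C₄^ m)
    ρ g = _≅_.to (hypercube≅ m) (signedAutomorphism g)

  -- Entries travel with positions, so the new array is read through the inverse; this makes it a
  -- left action.
  move : Signed n′ → MostPerfectHypercube m → MostPerfectHypercube m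
  move g H = record
    { index         = index H ∘ from
    ; bijective     = (λ {p} {q} e → trans (sym (strictlyInverseˡ p))
        (trans (cong to (proj₁ (bijective H) e)) (strictlyInverseˡ q)))
      , λ y → let p , e = proj₂ (bijective H) y in to p , λ { refl → e (strictlyInverseʳ p) }
    ; isMostPerfect = perfect⇒mostPerfect (perfect-cong
        (λ x → cong (entry H ∘ position {m} ∘ signed⁻¹ g) (sym (bits-position {m} x)))
        (perfect-signed⁻¹ g (rank-perfect H)))
    }
    where open Inverse (Automorphism.perm (ρ g))

  weylAction : Action (WeylB n′) (MostPerfectHypercubes m)
  weylAction = record
    { _·_    = λ w → move (word w)
    ; ·-cong = λ {w} {w′} {H} {K} w≈w′ H≈K p → trans (H≈K _)
        (cong (entry K ∘ position {m}) (signed⁻¹-cong {g = word w} {word w′}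
          (word-cong {w = w} {w′} w≈w′) (bits p)))
    ; ε-act  = λ H p → cong (entry H) (trans (cong (position {m}) (tabulate∘lookup (bits p))) (position-bits p))
    ; ∙-act  = λ w w′ H p → cong (entry H ∘ position {m}) (begin
        signed⁻¹ (word (w ++ w′)) (bits p)
          ≡⟨ signed⁻¹-cong {g = word (w ++ w′)} {word w B.∙ word w′} (word-homo w w′) (bits p) ⟩
        signed⁻¹ (word w B.∙ word w′) (bits p)
          ≡⟨ signed⁻¹-homo (word w) (word w′) (bits p) ⟩
        signed⁻¹ (word w′) (signed⁻¹ (word w) (bits p))
          ≡⟨ cong (signed⁻¹ (word w′)) (bits-position {m} (signed⁻¹ (word w) (bits p))) ⟨
        signed⁻¹ (word w′) (bits {m} (position (signed⁻¹ (word w) (bits p)))) ∎)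
    }

  -- The entries of a hypercube are distinct, so an element that fixes the single hypercube
  -- `binaryHypercube` already fixes every position. Faithfulness thus rests on existence.
  weylAction-faithful : Action.Faithful weylAction
  weylAction-faithful w fixes = word-injective {w = w} {[]} (signed-injective {g = word w} {B.ε} λ x →
    trans (cong (signed (word w)) (sym (fixed x))) (trans (signed-signed⁻¹ (word w) x) (sym (signed-ε x))))
    where
    H = binaryHypercube
    fixed : ∀ x → signed⁻¹ (word w) x ≡ x
    fixed x = position-injective {m} (signed⁻¹ (word w) x) x (trans
      (cong (position {m} ∘ signed⁻¹ (word w)) (sym (bits-position {m} x)))
      (proj₁ (bijective H) (toℕ-injective (ℕ.suc-injective (fixes H (position x))))))

  -- If `g` and `h` bring `H` and `K` to the common normal form, then h⁻¹g carries `H` to `K`; a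
  -- word for it exists because the reflections generate all signed permutations.
  weylAction-transitive : ∀ (H K : MostPerfectHypercube m) →
                          ∃[ w ] ∀ p → entry (Action._·_ weylAction w H) p ≡ entry K p
  weylAction-transitive H K = w , λ p → let x = signed⁻¹ (word w) (bits p) in cong suc (begin
    rank H x                      ≡⟨ H-form x ⟩
    binary (twist (signed g x))   ≡⟨ cong (binary ∘ twist) (signed-cong {g = g} {h B.∙ word w} g≈hw x) ⟩
    binary (twist (signed (h B.∙ word w) x)) ≡⟨ cong (binary ∘ twist) (signed-homo h (word w) x) ⟩
    binary (twist (signed h (signed (word w) x))) ≡⟨ K-form (signed (word w) x) ⟨
    rank K (signed (word w) x)    ≡⟨ cong (rank K) (signed-signed⁻¹ (word w) (bits p)) ⟩
    rank K (bits p)               ≡⟨ cong (toℕ ∘ index K) (position-bits p) ⟩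
    toℕ (index K p)               ∎)
    where
    g = proj₁ (rank-normalForm H)
    H-form = proj₂ (rank-normalForm H)
    h = proj₁ (rank-normalForm K)
    K-form = proj₂ (rank-normalForm K)
    open GroupProperties (C₂^ n′ ⋊S) using (\\-leftDividesˡ)
    w = proj₁ (word-surjective (h B.⁻¹ B.∙ g))
    g≈hw : g B.≈ h B.∙ word w
    g≈hw = B.sym {_} {h B.∙ word w} {g} (B.trans {_} {h B.∙ word w} {h B.∙ (h B.⁻¹ B.∙ g)} {g}
      (B.∙-cong {_} {h} {h} {word w} {h B.⁻¹ B.∙ g} (B.refl {_} {h}) (proj₂ (word-surjective (h B.⁻¹ B.∙ g))))
      (\\-leftDividesˡ h g))

theorem10 : (m : ℕ) → 1 ≤ m →
    Σ[ φ ∈ WeylB (2 * m) ≅ Aut (Q (2 * m)) ]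
    Σ[ ψ ∈ Aut (Q (2 * m)) ≅ Aut (C₄^ m) ]
    (Aut (C₄^ m) ≅ C₂^ (2 * m) ⋊S)
    × (Σ[ A ∈ Action (WeylB (2 * m)) (MostPerfectHypercubes m) ]
    PermutesPositionsVia A (_≅_.to ψ ∘ _≅_.to φ)
    × Action.Faithful A
    × Action.SingleOrbit A)
theorem10 m _ =
  ≅-trans (word≅ (2 * m)) (signed≅ (2 * m)) ,
  hypercube≅ m ,
  ≅-sym (≅-trans (signed≅ (2 * m)) (hypercube≅ m)) ,
  weylAction m ,
  (λ w H p → cong (entry H) (Inverse.strictlyInverseʳ
    (Automorphism.perm (_≅_.to (hypercube≅ m) (signedAutomorphism (word w)))) p)) ,
  weylAction-faithful m ,
  binaryHypercube m , weylAction-transitive m
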